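{- Let $S,T$ be as in the context. Every $\Sigma_1$ provability predicate $\mathrm{Pr}_T(x)$ of $T$ satisfying $\mathbf{E}^{\mathrm{U}}$, $\mathbf{CB}_{\exists}$ and $\mathbf{C}$ also satisfies $\mathbf{D2}$ and $\mathbf{D3}$.
   Context: $\mathcal{L}_A=\{0,\mathsf{s},+,\times,\leq\}$ is the language of first-order arithmetic, and "formula" means $\mathcal{L}_A$-formula; $\ulcorner\varphi\urcorner$ is the numeral of the Gödel number of $\varphi$. $\Sigma_1$ formulas are those of the form $\exists\vec{x}\,\delta$ with $\delta$ a $\Delta_0$ formula. $S$ and $T$ are consistent c.e. extensions of Peano Arithmetic $\mathsf{PA}$ in the language $\mathcal{L}_A$ such that $T$ is stronger than $S$ (every theorem of $S$ is a theorem of $T$; $S=T$ is allowed). A formula $\mathrm{Pr}_T(x)$ is a provability predicate of $T$ if for every formula $\varphi$: $T\vdash\varphi$ if and only if $S\vdash\mathrm{Pr}_T(\ulcorner\varphi\urcorner)$. A $\Sigma_1$ provability predicate is one that is a $\Sigma_1$ formula. $\ulcorner\varphi(\vec{\dot{x}})\urcorner$ is a term with free variables $\vec{x}$ for the primitive recursive function that computes from $\vec{n}$ the Gödel number of $\varphi(\overline{\vec{n}})$, the result of substituting the numerals of $\vec{n}$ for $\vec{x}$ in $\varphi(\vec{x})$. Conditions on $\mathrm{Pr}_T(x)$: - $\mathbf{E}^{\mathrm{U}}$: for all formulas $\varphi(\vec{x}),\psi(\vec{x})$, if $T\vdash\forall\vec{x}\,(\varphi(\vec{x})\leftrightarrow\psi(\vec{x}))$,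 then $S\vdash\forall\vec{x}\,(\mathrm{Pr}_T(\ulcorner\varphi(\vec{\dot{x}})\urcorner)\leftrightarrow\mathrm{Pr}_T(\ulcorner\psi(\vec{\dot{x}})\urcorner))$. - $\mathbf{CB}_{\exists}$: $S\vdash\exists\vec{x}\,\mathrm{Pr}_T(\ulcorner\varphi(\vec{\dot{x}})\urcorner)\to\mathrm{Pr}_T(\ulcorner\exists\vec{x}\,\varphi(\vec{x})\urcorner)$ for every formula $\varphi(\vec{x})$. - $\mathbf{C}$: $S\vdash\mathrm{Pr}_T(\ulcorner\varphi\urcorner)\land\mathrm{Pr}_T(\ulcorner\psi\urcorner)\to\mathrm{Pr}_T(\ulcorner\varphi\land\psi\urcorner)$ for all formulas $\varphi,\psi$. - $\mathbf{D2}$: $S\vdash\mathrm{Pr}_T(\ulcorner\varphi\to\psi\urcorner)\to(\mathrm{Pr}_T(\ulcorner\varphi\urcorner)\to\mathrm{Pr}_T(\ulcorner\psi\urcorner))$ for all formulas $\varphi,\psi$. - $\mathbf{D3}$: $S\vdash\mathrm{Pr}_T(\ulcorner\varphi\urcorner)\to\mathrm{Pr}_T(\ulcorner\mathrm{Pr}_T(\ulcorner\varphi\urcorner)\urcorner)$ for every formula $\varphi$. -}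

module Defs where

open import Data.Empty using (⊥-elim)
open import Data.Fin.Base using (Fin; zero; suc; toℕ; splitAt; _↑ˡ_)
open import Data.Fin.Properties using (toℕ-injective)
open import Data.List.Base using (List; []; _∷_; map)
open import Data.List.Membership.Propositional using (_∈_)
open import Data.Nat.Base using (ℕ; zero; suc; _+_; _*_; _<_; s≤s)
open import Data.Nat.Properties using (<-cmp; <-irrefl; +-cancelˡ-≡; +-monoʳ-≤; m≤m+n; *-mono-≤; suc-injective; module ≤-Reasoning)
open import Data.Nat.Tactic.RingSolver using (solve-∀)
open import Data.Product.Base using (Σ; ∃; _×_; _,_; proj₁; proj₂)
open import Data.Sum.Base using (_⊎_; inj₁; inj₂; [_,_]′; map₂)
open import Data.Vec.Base using (Vec; []; _∷_; lookup)
open import Function.Base using (_∘_; const)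
open import Function.Bundles using () renaming (_⇔_ to _⟺_)
open import Relation.Binary.Definitions using (tri<; tri≈; tri>)
open import Relation.Binary.PropositionalEquality using (_≡_; refl; sym; trans; cong; cong₂)
open import Relation.Nullary.Negation using (¬_)

-- Formula n: the free variables are among n given ones (de Bruijn indices).

infixl 7 _×ᵗ_
infixl 6 _+ᵗ_
infix  5 _≐_ _≤ᶠ_
infixr 4 ¬ᶠ_ ∀ᶠ_ ∃ᶠ_
infixr 3 _∧ᶠ_ _∨ᶠ_
infixr 2 _⇒_
infix  1 _⇔_

data Term (n : ℕ) : Set where
  var  : Fin n → Term n
  0ᵗ   : Term n
  sᵗ   : Term n → Term n
  _+ᵗ_ : Term n → Term n → Term n
  _×ᵗ_ : Term n → Term n → Term n

data Formula : ℕ → Set where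
  _≐_  : ∀ {n} → Term n → Term n → Formula n
  _≤ᶠ_ : ∀ {n} → Term n → Term n → Formula n
  ⊥ᶠ   : ∀ {n} → Formula n
  _⇒_  : ∀ {n} → Formula n → Formula n → Formula n
  _∧ᶠ_ : ∀ {n} → Formula n → Formula n → Formula n
  _∨ᶠ_ : ∀ {n} → Formula n → Formula n → Formula n
  ∀ᶠ_  : ∀ {n} → Formula (suc n) → Formula n
  ∃ᶠ_  : ∀ {n} → Formula (suc n) → Formula n

Sentence : Set
Sentence = Formula 0

¬ᶠ_ : ∀ {n} → Formula n → Formula n
¬ᶠ φ = φ ⇒ ⊥ᶠ

_⇔_ : ∀ {n} → Formula n → Formula n → Formula n
φ ⇔ ψ = (φ ⇒ ψ) ∧ᶠ (ψ ⇒ φ)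

-- ∀^ k and ∃^ k bind the variables with indices below k.

∀^ : ∀ k {n} → Formula (k + n) → Formula n
∀^ zero    φ = φ
∀^ (suc k) φ = ∀^ k (∀ᶠ φ)

∃^ : ∀ k {n} → Formula (k + n) → Formula n
∃^ zero    φ = φ
∃^ (suc k) φ = ∃^ k (∃ᶠ φ)

numeral : ∀ {n} → ℕ → Term n
numeral zero    = 0ᵗ
numeral (suc a) = sᵗ (numeral a)

renᵗ : ∀ {m n} → (Fin m → Fin n) → Term m → Term n
renᵗ ρ (var i)  = var (ρ i)
renᵗ ρ 0ᵗ       = 0ᵗ
renᵗ ρ (sᵗ t)   = sᵗ (renᵗ ρ t)
renᵗ ρ (t +ᵗ u) = renᵗ ρ t +ᵗ renᵗ ρ u
renᵗ ρ (t ×ᵗ u) = renᵗ ρ t ×ᵗ renᵗ ρ u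

wkᵗ : ∀ {n} → Term n → Term (suc n)
wkᵗ = renᵗ suc

subᵗ : ∀ {m n} → (Fin m → Term n) → Term m → Term n
subᵗ σ (var i)  = σ i
subᵗ σ 0ᵗ       = 0ᵗ
subᵗ σ (sᵗ t)   = sᵗ (subᵗ σ t)
subᵗ σ (t +ᵗ u) = subᵗ σ t +ᵗ subᵗ σ u
subᵗ σ (t ×ᵗ u) = subᵗ σ t ×ᵗ subᵗ σ u

lift : ∀ {m n} → (Fin m → Term n) → Fin (suc m) → Term (suc n)
lift σ zero    = var zero
lift σ (suc i) = wkᵗ (σ i)

sub : ∀ {m n} → (Fin m → Term n) → Formula m → Formula n
sub σ (t ≐ u)  = subᵗ σ t ≐ subᵗ σ u
sub σ (t ≤ᶠ u) = subᵗ σ t ≤ᶠ subᵗ σ u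
sub σ ⊥ᶠ       = ⊥ᶠ
sub σ (φ ⇒ ψ)  = sub σ φ ⇒ sub σ ψ
sub σ (φ ∧ᶠ ψ) = sub σ φ ∧ᶠ sub σ ψ
sub σ (φ ∨ᶠ ψ) = sub σ φ ∨ᶠ sub σ ψ
sub σ (∀ᶠ φ)   = ∀ᶠ sub (lift σ) φ
sub σ (∃ᶠ φ)   = ∃ᶠ sub (lift σ) φ

wk : ∀ {n} → Formula n → Formula (suc n)
wk = sub (var ∘ suc)

embed : ∀ {n} → Sentence → Formula n
embed = sub (λ ())

inst : ∀ {n} → Term n → Fin (suc n) → Term n
inst t zero    = t
inst t (suc i) = var i

_[_] : ∀ {n} → Formula (suc n) → Term n → Formula n
φ [ t ] = sub (inst t) φ

_⟨_⟩ : ∀ {n} → Formula 1 → Term n → Formula n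
φ ⟨ t ⟩ = sub (const t) φ

data Δ₀ : ∀ {n} → Formula n → Set where
  eq   : ∀ {n} {t u : Term n} → Δ₀ (t ≐ u)
  le   : ∀ {n} {t u : Term n} → Δ₀ (t ≤ᶠ u)
  bot  : ∀ {n} → Δ₀ {n} ⊥ᶠ
  imp  : ∀ {n} {φ ψ : Formula n} → Δ₀ φ → Δ₀ ψ → Δ₀ (φ ⇒ ψ)
  conj : ∀ {n} {φ ψ : Formula n} → Δ₀ φ → Δ₀ ψ → Δ₀ (φ ∧ᶠ ψ)
  disj : ∀ {n} {φ ψ : Formula n} → Δ₀ φ → Δ₀ ψ → Δ₀ (φ ∨ᶠ ψ)
  ball : ∀ {n} (t : Term n) {φ : Formula (suc n)} → Δ₀ φ → Δ₀ (∀ᶠ (var zero ≤ᶠ wkᵗ t ⇒ φ))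
  bex  : ∀ {n} (t : Term n) {φ : Formula (suc n)} → Δ₀ φ → Δ₀ (∃ᶠ (var zero ≤ᶠ wkᵗ t ∧ᶠ φ))

Σ₁ : ∀ {n} → Formula n → Set
Σ₁ {n} φ = ∃ λ k → Σ (Formula (k + n)) λ δ → Δ₀ δ × φ ≡ ∃^ k δ

Theory : Set₁
Theory = Sentence → Set

infix 0 _∣_⊢_ _⊢_

data _∣_⊢_ (T : Theory) : ∀ {n} → List (Formula n) → Formula n → Set where
  ax  : ∀ {n} {Γ : List (Formula n)} {σ} → T σ → T ∣ Γ ⊢ embed σ
  hyp : ∀ {n} {Γ : List (Formula n)} {φ} → φ ∈ Γ → T ∣ Γ ⊢ φ
  raa : ∀ {n} {Γ : List (Formula n)} {φ} → T ∣ (¬ᶠ φ) ∷ Γ ⊢ ⊥ᶠ → T ∣ Γ ⊢ φ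
  ⇒I  : ∀ {n} {Γ : List (Formula n)} {φ ψ} → T ∣ φ ∷ Γ ⊢ ψ → T ∣ Γ ⊢ φ ⇒ ψ
  ⇒E  : ∀ {n} {Γ : List (Formula n)} {φ ψ} → T ∣ Γ ⊢ φ ⇒ ψ → T ∣ Γ ⊢ φ → T ∣ Γ ⊢ ψ
  ∧I  : ∀ {n} {Γ : List (Formula n)} {φ ψ} → T ∣ Γ ⊢ φ → T ∣ Γ ⊢ ψ → T ∣ Γ ⊢ φ ∧ᶠ ψ
  ∧E₁ : ∀ {n} {Γ : List (Formula n)} {φ ψ} → T ∣ Γ ⊢ φ ∧ᶠ ψ → T ∣ Γ ⊢ φ
  ∧E₂ : ∀ {n} {Γ : List (Formula n)} {φ ψ} → T ∣ Γ ⊢ φ ∧ᶠ ψ → T ∣ Γ ⊢ ψ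
  ∨I₁ : ∀ {n} {Γ : List (Formula n)} {φ ψ} → T ∣ Γ ⊢ φ → T ∣ Γ ⊢ φ ∨ᶠ ψ
  ∨I₂ : ∀ {n} {Γ : List (Formula n)} {φ ψ} → T ∣ Γ ⊢ ψ → T ∣ Γ ⊢ φ ∨ᶠ ψ
  ∨E  : ∀ {n} {Γ : List (Formula n)} {φ ψ χ} → T ∣ Γ ⊢ φ ∨ᶠ ψ → T ∣ φ ∷ Γ ⊢ χ → T ∣ ψ ∷ Γ ⊢ χ → T ∣ Γ ⊢ χ
  ∀I  : ∀ {n} {Γ : List (Formula n)} {φ} → T ∣ map wk Γ ⊢ φ → T ∣ Γ ⊢ ∀ᶠ φ
  ∀E  : ∀ {n} {Γ : List (Formula n)} {φ} → T ∣ Γ ⊢ ∀ᶠ φ → ∀ t → T ∣ Γ ⊢ φ [ t ]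
  ∃I  : ∀ {n} {Γ : List (Formula n)} {φ} t → T ∣ Γ ⊢ φ [ t ] → T ∣ Γ ⊢ ∃ᶠ φ
  ∃E  : ∀ {n} {Γ : List (Formula n)} {φ χ} → T ∣ Γ ⊢ ∃ᶠ φ → T ∣ φ ∷ map wk Γ ⊢ wk χ → T ∣ Γ ⊢ χ
  =I  : ∀ {n} {Γ : List (Formula n)} t → T ∣ Γ ⊢ t ≐ t
  =E  : ∀ {n} {Γ : List (Formula n)} {t u} φ → T ∣ Γ ⊢ t ≐ u → T ∣ Γ ⊢ φ [ t ] → T ∣ Γ ⊢ φ [ u ]

_⊢_ : ∀ {n} → Theory → Formula n → Set
T ⊢ φ = T ∣ [] ⊢ φ

Consistent : Theory → Set
Consistent T = ¬ (T ⊢ ⊥ᶠ {0})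

infix 4 _≼_

_≼_ : Theory → Theory → Set
S ≼ T = ∀ {n} (φ : Formula n) → S ⊢ φ → T ⊢ φ

x₀ : ∀ {n} → Term (suc n)
x₀ = var zero

x₁ : ∀ {n} → Term (suc (suc n))
x₁ = var (suc zero)

s-at₀ : ∀ {n} → Fin (suc n) → Term (suc n)
s-at₀ zero    = sᵗ (var zero)
s-at₀ (suc i) = var (suc i)

-- The induction scheme has arbitrarily many parameters, closed off by ∀^ k.

data PA : Theory where
  s≠0   : PA (∀ᶠ ¬ᶠ (sᵗ x₀ ≐ 0ᵗ))
  s-inj : PA (∀ᶠ ∀ᶠ (sᵗ x₁ ≐ sᵗ x₀ ⇒ x₁ ≐ x₀))
  +-0   : PA (∀ᶠ (x₀ +ᵗ 0ᵗ ≐ x₀))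
  +-s   : PA (∀ᶠ ∀ᶠ (x₁ +ᵗ sᵗ x₀ ≐ sᵗ (x₁ +ᵗ x₀)))
  ×-0   : PA (∀ᶠ (x₀ ×ᵗ 0ᵗ ≐ 0ᵗ))
  ×-s   : PA (∀ᶠ ∀ᶠ (x₁ ×ᵗ sᵗ x₀ ≐ x₁ ×ᵗ x₀ +ᵗ x₁))
  ≤-def : PA (∀ᶠ ∀ᶠ (x₁ ≤ᶠ x₀ ⇔ ∃ᶠ (x₀ +ᵗ wkᵗ x₁ ≐ wkᵗ x₀)))
  ind   : ∀ k (φ : Formula (suc (k + 0))) →
          PA (∀^ k (φ [ 0ᵗ ] ∧ᶠ (∀ᶠ (φ ⇒ sub s-at₀ φ)) ⇒ ∀ᶠ φ))

-- pair is injective but not onto.  It is a polynomial, so it is given by a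
-- term of the language (pairᵗ below).

pair : ℕ → ℕ → ℕ
pair a b = (a + b) * (a + b) + a

-- Every term is uniquely s(…s(u)…), with k occurrences of s and u not of the
-- form s(v).  It is coded by the pair of k = sCount and of a code of u; the
-- numeral of a thus has code pair a 0 = a * a + a.

mutual
  gnᵗ : ∀ {n} → Term n → ℕ
  gnᵗ t = pair (sCount t) (core t)

  sCount : ∀ {n} → Term n → ℕ
  sCount (sᵗ t) = suc (sCount t)
  sCount _      = 0

  core : ∀ {n} → Term n → ℕ
  core (var i)  = pair 1 (toℕ i)
  core 0ᵗ       = 0
  core (sᵗ t)   = core t
  core (t +ᵗ u) = pair 2 (pair (gnᵗ t) (gnᵗ u))
  core (t ×ᵗ u) = pair 3 (pair (gnᵗ t) (gnᵗ u))

gn : ∀ {n} → Formula n → ℕ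
gn (t ≐ u)  = pair 0 (pair (gnᵗ t) (gnᵗ u))
gn (t ≤ᶠ u) = pair 1 (pair (gnᵗ t) (gnᵗ u))
gn ⊥ᶠ       = pair 2 0
gn (φ ⇒ ψ)  = pair 3 (pair (gn φ) (gn ψ))
gn (φ ∧ᶠ ψ) = pair 4 (pair (gn φ) (gn ψ))
gn (φ ∨ᶠ ψ) = pair 5 (pair (gn φ) (gn ψ))
gn (∀ᶠ φ)   = pair 6 (gn φ)
gn (∃ᶠ φ)   = pair 7 (gn φ)

⌜_⌝ : ∀ {n} → Formula n → Term 0
⌜ φ ⌝ = numeral (gn φ)

-- The dotted Gödel term.  A substitution of numerals for variables changes
-- the code of a formula in a polynomial way: a variable with value x
-- contributes sCount x and core 0.  Hence the primitive recursive function
-- computing gn (φ(numerals of x⃗)) from x⃗ is given by a term of the language,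
-- obtained by following the clauses of gn.
--
-- An assignment Fin m → Fin p ⊎ ℕ says for each variable of the formula
-- whether it is dotted (and which variable of the resulting term holds its
-- value), or else its index after the substitution.

pairᵗ : ∀ {n} → Term n → Term n → Term n
pairᵗ t u = (t +ᵗ u) ×ᵗ (t +ᵗ u) +ᵗ t

Dots : ℕ → ℕ → Set
Dots m p = Fin m → Fin p ⊎ ℕ

liftDots : ∀ {m p} → Dots m p → Dots (suc m) p
liftDots d zero    = inj₂ 0
liftDots d (suc i) = map₂ suc (d i)

mutual
  dotᵗ : ∀ {m p} → Dots m p → Term m → Term p
  dotᵗ d t = pairᵗ (sCountᵗ d t) (coreᵗ d t)

  sCountᵗ : ∀ {m p} → Dots m p → Term m → Term p
  sCountᵗ d (var i)  = [ var , const 0ᵗ ]′ (d i)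
  sCountᵗ d 0ᵗ       = 0ᵗ
  sCountᵗ d (sᵗ t)   = sᵗ (sCountᵗ d t)
  sCountᵗ d (_ +ᵗ _) = 0ᵗ
  sCountᵗ d (_ ×ᵗ _) = 0ᵗ

  coreᵗ : ∀ {m p} → Dots m p → Term m → Term p
  coreᵗ d (var i)  = [ const 0ᵗ , (λ j → pairᵗ (numeral 1) (numeral j)) ]′ (d i)
  coreᵗ d 0ᵗ       = 0ᵗ
  coreᵗ d (sᵗ t)   = coreᵗ d t
  coreᵗ d (t +ᵗ u) = pairᵗ (numeral 2) (pairᵗ (dotᵗ d t) (dotᵗ d u))
  coreᵗ d (t ×ᵗ u) = pairᵗ (numeral 3) (pairᵗ (dotᵗ d t) (dotᵗ d u))

dot : ∀ {m p} → Dots m p → Formula m → Term p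
dot d (t ≐ u)  = pairᵗ (numeral 0) (pairᵗ (dotᵗ d t) (dotᵗ d u))
dot d (t ≤ᶠ u) = pairᵗ (numeral 1) (pairᵗ (dotᵗ d t) (dotᵗ d u))
dot d ⊥ᶠ       = pairᵗ (numeral 2) (numeral 0)
dot d (φ ⇒ ψ)  = pairᵗ (numeral 3) (pairᵗ (dot d φ) (dot d ψ))
dot d (φ ∧ᶠ ψ) = pairᵗ (numeral 4) (pairᵗ (dot d φ) (dot d ψ))
dot d (φ ∨ᶠ ψ) = pairᵗ (numeral 5) (pairᵗ (dot d φ) (dot d ψ))
dot d (∀ᶠ φ)   = pairᵗ (numeral 6) (dot (liftDots d) φ)
dot d (∃ᶠ φ)   = pairᵗ (numeral 7) (dot (liftDots d) φ)

firstDotted : ∀ k {n} → Dots (k + n) (k + 0)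
firstDotted k i = [ (λ j → inj₁ (j ↑ˡ 0)) , (λ j → inj₂ (toℕ j)) ]′ (splitAt k i)

-- ⌜ k ∙ φ ⌝ has the variables with index below k dotted and the remaining n
-- (if any) left as variables of the coded formula.

⌜_∙_⌝ : ∀ k {n} → Formula (k + n) → Term (k + 0)
⌜ k ∙ φ ⌝ = dot (firstDotted k) φ

private
  pair-sum-≮ : ∀ a b c d → pair a b ≡ pair c d → ¬ (a + b < c + d)
  pair-sum-≮ a b c d e lt = <-irrefl e (begin-strict
    (a + b) * (a + b) + a                     ≤⟨ +-monoʳ-≤ ((a + b) * (a + b)) (m≤m+n a b) ⟩
    (a + b) * (a + b) + (a + b)               <⟨ m<1+m+n _ (a + b) ⟩
    suc ((a + b) * (a + b) + (a + b) + (a + b)) ≡⟨ square (a + b) ⟩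
    suc (a + b) * suc (a + b)                 ≤⟨ *-mono-≤ lt lt ⟩
    (c + d) * (c + d)                         ≤⟨ m≤m+n _ c ⟩
    (c + d) * (c + d) + c                     ∎)
    where
    open ≤-Reasoning
    m<1+m+n : ∀ m n → m < suc (m + n)
    m<1+m+n m n = s≤s (m≤m+n m n)
    square : ∀ x → suc (x * x + x + x) ≡ suc x * suc x
    square = solve-∀

pair-injective : ∀ a b c d → pair a b ≡ pair c d → a ≡ c × b ≡ d
pair-injective a b c d e with <-cmp (a + b) (c + d)
... | tri< lt _ _ = ⊥-elim (pair-sum-≮ a b c d e lt)
... | tri> _ _ gt = ⊥-elim (pair-sum-≮ c d a b (sym e) gt)
... | tri≈ _ s≡ _ = a≡c , +-cancelˡ-≡ a b d (trans s≡ (cong (_+ d) (sym a≡c)))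
  where
  a≡c : a ≡ c
  a≡c = +-cancelˡ-≡ ((a + b) * (a + b)) a c (trans e (cong (λ x → x * x + c) (sym s≡)))

private
  split : ∀ a b c d e → pair a (pair b c) ≡ pair a (pair d e) → b ≡ d × c ≡ e
  split a b c d e = pair-injective b c d e ∘ proj₂ ∘ pair-injective a (pair b c) a (pair d e)

  mutual
    gnᵗ-inj : ∀ {n} (t u : Term n) → gnᵗ t ≡ gnᵗ u → t ≡ u
    gnᵗ-inj t u e with h , c ← pair-injective (sCount t) (core t) (sCount u) (core u) e = parts-inj t u h c

    gnᵗ-inj₂ : ∀ {n} a (t u t′ u′ : Term n) →
               pair a (pair (gnᵗ t) (gnᵗ u)) ≡ pair a (pair (gnᵗ t′) (gnᵗ u′)) → t ≡ t′ × u ≡ u′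
    gnᵗ-inj₂ a t u t′ u′ e with p , q ← split a (gnᵗ t) (gnᵗ u) (gnᵗ t′) (gnᵗ u′) e =
      gnᵗ-inj t t′ p , gnᵗ-inj u u′ q

    parts-inj : ∀ {n} (t u : Term n) → sCount t ≡ sCount u → core t ≡ core u → t ≡ u
    parts-inj (var i)  (var j)    _ e = cong var (toℕ-injective (proj₂ (pair-injective 1 (toℕ i) 1 (toℕ j) e)))
    parts-inj 0ᵗ       0ᵗ         _ _ = refl
    parts-inj (sᵗ t)   (sᵗ u)     h e = cong sᵗ (parts-inj t u (suc-injective h) e)
    parts-inj (t +ᵗ u) (t′ +ᵗ u′) _ e with refl , refl ← gnᵗ-inj₂ 2 t u t′ u′ e = refl
    parts-inj (t ×ᵗ u) (t′ ×ᵗ u′) _ e with refl , refl ← gnᵗ-inj₂ 3 t u t′ u′ e = refl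
    parts-inj (var i)  (t +ᵗ u)   _ e with () ← proj₁ (pair-injective 1 (toℕ i) 2 (pair (gnᵗ t) (gnᵗ u)) e)
    parts-inj (var i)  (t ×ᵗ u)   _ e with () ← proj₁ (pair-injective 1 (toℕ i) 3 (pair (gnᵗ t) (gnᵗ u)) e)
    parts-inj (t +ᵗ u) (var i)    _ e with () ← proj₁ (pair-injective 2 (pair (gnᵗ t) (gnᵗ u)) 1 (toℕ i) e)
    parts-inj (t ×ᵗ u) (var i)    _ e with () ← proj₁ (pair-injective 3 (pair (gnᵗ t) (gnᵗ u)) 1 (toℕ i) e)
    parts-inj (t +ᵗ u) (t′ ×ᵗ u′) _ e with () ← proj₁ (pair-injective 2 (pair (gnᵗ t) (gnᵗ u)) 3 (pair (gnᵗ t′) (gnᵗ u′)) e)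
    parts-inj (t ×ᵗ u) (t′ +ᵗ u′) _ e with () ← proj₁ (pair-injective 3 (pair (gnᵗ t) (gnᵗ u)) 2 (pair (gnᵗ t′) (gnᵗ u′)) e)

  tagOf : ∀ {n} → Formula n → ℕ
  tagOf (_ ≐ _)  = 0
  tagOf (_ ≤ᶠ _) = 1
  tagOf ⊥ᶠ       = 2
  tagOf (_ ⇒ _)  = 3
  tagOf (_ ∧ᶠ _) = 4
  tagOf (_ ∨ᶠ _) = 5
  tagOf (∀ᶠ _)   = 6
  tagOf (∃ᶠ _)   = 7

  body : ∀ {n} → Formula n → ℕ
  body (t ≐ u)  = pair (gnᵗ t) (gnᵗ u)
  body (t ≤ᶠ u) = pair (gnᵗ t) (gnᵗ u)
  body ⊥ᶠ       = 0
  body (φ ⇒ ψ)  = pair (gn φ) (gn ψ)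
  body (φ ∧ᶠ ψ) = pair (gn φ) (gn ψ)
  body (φ ∨ᶠ ψ) = pair (gn φ) (gn ψ)
  body (∀ᶠ φ)   = gn φ
  body (∃ᶠ φ)   = gn φ

  gn-split : ∀ {n} (φ : Formula n) → gn φ ≡ pair (tagOf φ) (body φ)
  gn-split (_ ≐ _)  = refl
  gn-split (_ ≤ᶠ _) = refl
  gn-split ⊥ᶠ       = refl
  gn-split (_ ⇒ _)  = refl
  gn-split (_ ∧ᶠ _) = refl
  gn-split (_ ∨ᶠ _) = refl
  gn-split (∀ᶠ _)   = refl
  gn-split (∃ᶠ _)   = refl

  tag-cong : ∀ {n} (φ ψ : Formula n) → gn φ ≡ gn ψ → tagOf φ ≡ tagOf ψ
  tag-cong φ ψ e =
    proj₁ (pair-injective (tagOf φ) (body φ) (tagOf ψ) (body ψ)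
      (trans (sym (gn-split φ)) (trans e (gn-split ψ))))

  mutual
    gn-inj : ∀ {n} (φ ψ : Formula n) → gn φ ≡ gn ψ → φ ≡ ψ
    gn-inj φ ψ e = gn-inj′ φ ψ (tag-cong φ ψ e) e

    gn-inj₂ : ∀ {n} a (φ ψ φ′ ψ′ : Formula n) →
              pair a (pair (gn φ) (gn ψ)) ≡ pair a (pair (gn φ′) (gn ψ′)) → φ ≡ φ′ × ψ ≡ ψ′
    gn-inj₂ a φ ψ φ′ ψ′ e with p , q ← split a (gn φ) (gn ψ) (gn φ′) (gn ψ′) e =
      gn-inj φ φ′ p , gn-inj ψ ψ′ q

    gn-inj′ : ∀ {n} (φ ψ : Formula n) → tagOf φ ≡ tagOf ψ → gn φ ≡ gn ψ → φ ≡ ψ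
    gn-inj′ (t ≐ u)  (t′ ≐ u′)  _ e with refl , refl ← gnᵗ-inj₂ 0 t u t′ u′ e = refl
    gn-inj′ (t ≤ᶠ u) (t′ ≤ᶠ u′) _ e with refl , refl ← gnᵗ-inj₂ 1 t u t′ u′ e = refl
    gn-inj′ ⊥ᶠ       ⊥ᶠ         _ e = refl
    gn-inj′ (φ ⇒ ψ)  (φ′ ⇒ ψ′)  _ e with refl , refl ← gn-inj₂ 3 φ ψ φ′ ψ′ e = refl
    gn-inj′ (φ ∧ᶠ ψ) (φ′ ∧ᶠ ψ′) _ e with refl , refl ← gn-inj₂ 4 φ ψ φ′ ψ′ e = refl
    gn-inj′ (φ ∨ᶠ ψ) (φ′ ∨ᶠ ψ′) _ e with refl , refl ← gn-inj₂ 5 φ ψ φ′ ψ′ e = refl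
    gn-inj′ (∀ᶠ φ)   (∀ᶠ ψ)     _ e = cong ∀ᶠ_ (gn-inj φ ψ (proj₂ (pair-injective 6 (gn φ) 6 (gn ψ) e)))
    gn-inj′ (∃ᶠ φ)   (∃ᶠ ψ)     _ e = cong ∃ᶠ_ (gn-inj φ ψ (proj₂ (pair-injective 7 (gn φ) 7 (gn ψ) e)))

gn-injective : ∀ {n} (φ ψ : Formula n) → gn φ ≡ gn ψ → φ ≡ ψ
gn-injective = gn-inj

value : ∀ {n} → (Fin n → ℕ) → Term n → ℕ
value a (var i)  = a i
value a 0ᵗ       = 0
value a (sᵗ t)   = suc (value a t)
value a (t +ᵗ u) = value a t + value a u
value a (t ×ᵗ u) = value a t * value a u

fillNumerals : ∀ k {n} → (Fin (k + 0) → ℕ) → Fin (k + n) → Term n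
fillNumerals k a i = [ (λ j → numeral (a (j ↑ˡ 0))) , var ]′ (splitAt k i)

private
  value-numeral : ∀ {n} (a : Fin n → ℕ) b → value a (numeral b) ≡ b
  value-numeral a zero    = refl
  value-numeral a (suc b) = cong suc (value-numeral a b)

  wk-numeral : ∀ {n} b → wkᵗ {n} (numeral b) ≡ numeral b
  wk-numeral zero    = refl
  wk-numeral (suc b) = cong sᵗ (wk-numeral b)

  sCount-numeral : ∀ {n} b → sCount (numeral {n} b) ≡ b
  sCount-numeral zero    = refl
  sCount-numeral (suc b) = cong suc (sCount-numeral b)

  core-numeral : ∀ {n} b → core (numeral {n} b) ≡ 0
  core-numeral zero    = refl
  core-numeral (suc b) = core-numeral b

  Fits : ∀ {p q} → (Fin p → ℕ) → Fin p ⊎ ℕ → Term q → Set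
  Fits a (inj₁ x) t = t ≡ numeral (a x)
  Fits a (inj₂ j) t = ∃ λ v → t ≡ var v × toℕ v ≡ j

  module _ {p} (a : Fin p → ℕ) where

    value-tagged : ∀ b t c → value a t ≡ c → value a (pairᵗ (numeral b) t) ≡ pair b c
    value-tagged b t c = cong₂ pair (value-numeral a b)

    value-tagged₂ : ∀ b t u c c′ → value a t ≡ c → value a u ≡ c′ →
                    value a (pairᵗ (numeral b) (pairᵗ t u)) ≡ pair b (pair c c′)
    value-tagged₂ b t u c c′ p q = value-tagged b (pairᵗ t u) (pair c c′) (cong₂ pair p q)

    fits-lift : ∀ {m q} (d : Dots m p) (σ : Fin m → Term q) → (∀ i → Fits a (d i) (σ i)) →
                ∀ i → Fits a (liftDots d i) (lift σ i)
    fits-lift d σ f zero    = zero , refl , refl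
    fits-lift d σ f (suc i) with d i | f i
    ... | inj₁ x | e           = trans (cong wkᵗ e) (wk-numeral (a x))
    ... | inj₂ j | v , e , e′  = suc v , cong wkᵗ e , cong suc e′

    module _ {m q} (d : Dots m p) (σ : Fin m → Term q) (f : ∀ i → Fits a (d i) (σ i)) where
      mutual
        dotᵗ-value : ∀ t → value a (dotᵗ d t) ≡ gnᵗ (subᵗ σ t)
        dotᵗ-value t = cong₂ pair (sCountᵗ-value t) (coreᵗ-value t)

        sCountᵗ-value : ∀ t → value a (sCountᵗ d t) ≡ sCount (subᵗ σ t)
        sCountᵗ-value (var i) with d i | f i
        ... | inj₁ x | e          = sym (trans (cong sCount e) (sCount-numeral (a x)))
        ... | inj₂ j | v , e , e′ = sym (cong sCount e)
        sCountᵗ-value 0ᵗ       = refl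
        sCountᵗ-value (sᵗ t)   = cong suc (sCountᵗ-value t)
        sCountᵗ-value (_ +ᵗ _) = refl
        sCountᵗ-value (_ ×ᵗ _) = refl

        coreᵗ-value : ∀ t → value a (coreᵗ d t) ≡ core (subᵗ σ t)
        coreᵗ-value (var i) with d i | f i
        ... | inj₁ x | e          = sym (trans (cong core e) (core-numeral (a x)))
        ... | inj₂ j | v , e , e′ = trans (value-tagged 1 (numeral j) (toℕ v) (trans (value-numeral a j) (sym e′))) (sym (cong core e))
        coreᵗ-value 0ᵗ       = refl
        coreᵗ-value (sᵗ t)   = coreᵗ-value t
        coreᵗ-value (t +ᵗ u) = value-tagged₂ 2 (dotᵗ d t) (dotᵗ d u) (gnᵗ (subᵗ σ t)) (gnᵗ (subᵗ σ u)) (dotᵗ-value t) (dotᵗ-value u)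
        coreᵗ-value (t ×ᵗ u) = value-tagged₂ 3 (dotᵗ d t) (dotᵗ d u) (gnᵗ (subᵗ σ t)) (gnᵗ (subᵗ σ u)) (dotᵗ-value t) (dotᵗ-value u)

    dot-value : ∀ {m q} (d : Dots m p) (σ : Fin m → Term q) → (∀ i → Fits a (d i) (σ i)) →
                ∀ φ → value a (dot d φ) ≡ gn (sub σ φ)
    dot-value d σ f (t ≐ u)  = value-tagged₂ 0 (dotᵗ d t) (dotᵗ d u) (gnᵗ (subᵗ σ t)) (gnᵗ (subᵗ σ u)) (dotᵗ-value d σ f t) (dotᵗ-value d σ f u)
    dot-value d σ f (t ≤ᶠ u) = value-tagged₂ 1 (dotᵗ d t) (dotᵗ d u) (gnᵗ (subᵗ σ t)) (gnᵗ (subᵗ σ u)) (dotᵗ-value d σ f t) (dotᵗ-value d σ f u)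
    dot-value d σ f ⊥ᶠ       = refl
    dot-value d σ f (φ ⇒ ψ)  = value-tagged₂ 3 (dot d φ) (dot d ψ) (gn (sub σ φ)) (gn (sub σ ψ)) (dot-value d σ f φ) (dot-value d σ f ψ)
    dot-value d σ f (φ ∧ᶠ ψ) = value-tagged₂ 4 (dot d φ) (dot d ψ) (gn (sub σ φ)) (gn (sub σ ψ)) (dot-value d σ f φ) (dot-value d σ f ψ)
    dot-value d σ f (φ ∨ᶠ ψ) = value-tagged₂ 5 (dot d φ) (dot d ψ) (gn (sub σ φ)) (gn (sub σ ψ)) (dot-value d σ f φ) (dot-value d σ f ψ)
    dot-value d σ f (∀ᶠ φ)   = value-tagged 6 (dot (liftDots d) φ) (gn (sub (lift σ) φ)) (dot-value (liftDots d) (lift σ) (fits-lift d σ f) φ)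
    dot-value d σ f (∃ᶠ φ)   = value-tagged 7 (dot (liftDots d) φ) (gn (sub (lift σ) φ)) (dot-value (liftDots d) (lift σ) (fits-lift d σ f) φ)

dotted-correct : ∀ k {n} (a : Fin (k + 0) → ℕ) (φ : Formula (k + n)) →
                 value a ⌜ k ∙ φ ⌝ ≡ gn (sub (fillNumerals k a) φ)
dotted-correct k a = dot-value a (firstDotted k) (fillNumerals k a) fits
  where
  fits : ∀ i → Fits a (firstDotted k i) (fillNumerals k a i)
  fits i with splitAt k i
  ... | inj₁ j = refl
  ... | inj₂ j = j , refl , refl

-- Kleene's partial recursive functions, with their graphs.

data Rec : ℕ → Set where
  zeroᴿ : Rec 0
  sucᴿ  : Rec 1
  proj  : ∀ {n} → Fin n → Rec n
  comp  : ∀ {m n} → Rec m → (Fin m → Rec n) → Rec n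
  prim  : ∀ {n} → Rec n → Rec (suc (suc n)) → Rec (suc n)
  mu    : ∀ {n} → Rec (suc n) → Rec n

infix 4 _·_↦_

data _·_↦_ : ∀ {n} → Rec n → Vec ℕ n → ℕ → Set where
  ↦zero  : zeroᴿ · [] ↦ 0
  ↦suc   : ∀ {x} → sucᴿ · x ∷ [] ↦ suc x
  ↦proj  : ∀ {n} {i : Fin n} {xs} → proj i · xs ↦ lookup xs i
  ↦comp  : ∀ {m n} {f : Rec m} {gs : Fin m → Rec n} {xs y} (ys : Vec ℕ m) →
           (∀ i → gs i · xs ↦ lookup ys i) → f · ys ↦ y → comp f gs · xs ↦ y
  ↦prim₀ : ∀ {n} {g : Rec n} {h xs y} → g · xs ↦ y → prim g h · 0 ∷ xs ↦ y
  ↦primₛ : ∀ {n} {g : Rec n} {h xs x y z} →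
           prim g h · x ∷ xs ↦ z → h · x ∷ z ∷ xs ↦ y → prim g h · suc x ∷ xs ↦ y
  ↦mu    : ∀ {n} {f : Rec (suc n)} {xs y} → f · y ∷ xs ↦ 0 →
           (∀ z → z < y → ∃ λ v → f · z ∷ xs ↦ suc v) → mu f · xs ↦ y

IsCE : (ℕ → Set) → Set
IsCE A = Σ (Rec 1) λ f → ∀ x → A x ⟺ ∃ λ y → f · x ∷ [] ↦ y

-- A theory is identified with its set of theorems.

CE : Theory → Set
CE T = IsCE (λ x → Σ Sentence λ σ → (T ⊢ σ) × gn σ ≡ x)

ProvabilityPredicate : Theory → Theory → Formula 1 → Set
ProvabilityPredicate S T Pr = ∀ {n} (φ : Formula n) → (T ⊢ φ) ⟺ (S ⊢ Pr ⟨ ⌜ φ ⌝ ⟩)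

-- In Eᵁ and CB∃ the tuple x⃗ consists of the first k variables; φ and ψ may
-- have n further free variables, which are not dotted.  For n = 0 all free
-- variables are in x⃗, and for k = 0 the tuple is empty.

Eᵁ : Theory → Theory → Formula 1 → Set
Eᵁ S T Pr = ∀ k {n} (φ ψ : Formula (k + n)) →
  T ⊢ ∀^ k (φ ⇔ ψ) → S ⊢ ∀^ k (Pr ⟨ ⌜ k ∙ φ ⌝ ⟩ ⇔ Pr ⟨ ⌜ k ∙ ψ ⌝ ⟩)

CB∃ : Theory → Formula 1 → Set
CB∃ S Pr = ∀ k {n} (φ : Formula (k + n)) →
  S ⊢ ∃^ k (Pr ⟨ ⌜ k ∙ φ ⌝ ⟩) ⇒ Pr ⟨ ⌜ ∃^ k φ ⌝ ⟩

C : Theory → Formula 1 → Set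
C S Pr = ∀ {n} (φ ψ : Formula n) →
  S ⊢ Pr ⟨ ⌜ φ ⌝ ⟩ ∧ᶠ Pr ⟨ ⌜ ψ ⌝ ⟩ ⇒ Pr ⟨ ⌜ φ ∧ᶠ ψ ⌝ ⟩

D2 : Theory → Formula 1 → Set
D2 S Pr = ∀ {n} (φ ψ : Formula n) →
  S ⊢ Pr ⟨ ⌜ φ ⇒ ψ ⌝ ⟩ ⇒ Pr ⟨ ⌜ φ ⌝ ⟩ ⇒ Pr ⟨ ⌜ ψ ⌝ ⟩

D3 : Theory → Formula 1 → Set
D3 S Pr = ∀ {n} (φ : Formula n) →
  S ⊢ Pr ⟨ ⌜ φ ⌝ ⟩ ⇒ Pr ⟨ ⌜ Pr ⟨ ⌜ φ ⌝ ⟩ ⌝ ⟩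

{-# OPTIONS --safe #-}

-- D3: write □φ for Pr(⌜φ(ẋ)⌝), and say that δ relativises if Eᵁ
-- holds under the hypothesis δ: whenever T + δ ⊢ χ ↔ χ′, also
-- S + δ ⊢ □χ ↔ □χ′.  Such formulas are closed under ∧, ∨ and ∃, and x = t
-- relativises if t is a numeral or a successor of a variable, because one may
-- substitute t for x inside □.  An induction in S, whose step is one
-- application of Eᵁ to an equivalence such as y + 1 = a + (b + 1) ↔ y = a + b,
-- extends this to the graphs of + and × and to bounded ∀, hence to all Σ₁
-- formulas.  If δ is Pr itself, then T + δ ⊢ Pr ↔ ⊤ gives S + Pr(x) ⊢ □Pr ↔ □⊤,
-- that is D3.
--
-- D2: it follows from C once Pr is monotone, and CB∃ gives monotonicity because a
-- consequence ψ of φ is equivalent to ∃x χ(x) for some χ with χ(0) ↔ φ.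

module Submission where

open import Defs
open import Data.Fin.Base using (Fin; zero; suc; splitAt)
open import Data.Fin.Properties using (splitAt⁻¹-↑ˡ)
open import Data.List.Base using (List; []; _∷_; map)
open import Data.List.Membership.Propositional using (_∈_)
open import Data.List.Membership.Propositional.Properties using (∈-map⁺; ∈-map⁻)
open import Data.List.Relation.Unary.Any using (here; there)
open import Data.Nat.Base using (ℕ; zero; suc; _+_; _*_)
open import Data.Nat.Properties using (+-identityʳ; +-suc; *-suc; +-comm; *-zeroʳ)
open import Data.Product.Base using (∃; _×_; _,_; proj₁; proj₂)
open import Data.Sum.Base using (_⊎_; inj₁; inj₂; map₂)
open import Data.Vec.Base using (Vec; []; _∷_; lookup)
open import Function.Base using (_∘_; const)
open import Function.Bundles using (Equivalence)
open import Relation.Binary.PropositionalEquality using (_≡_; refl; sym; trans; cong; cong₂; subst)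

-- Substitution

subᵗ-cong : ∀ {m n} {σ τ : Fin m → Term n} → (∀ i → σ i ≡ τ i) → ∀ t → subᵗ σ t ≡ subᵗ τ t
subᵗ-cong e (var i)  = e i
subᵗ-cong e 0ᵗ       = refl
subᵗ-cong e (sᵗ t)   = cong sᵗ (subᵗ-cong e t)
subᵗ-cong e (t +ᵗ u) = cong₂ _+ᵗ_ (subᵗ-cong e t) (subᵗ-cong e u)
subᵗ-cong e (t ×ᵗ u) = cong₂ _×ᵗ_ (subᵗ-cong e t) (subᵗ-cong e u)

subᵗ-id : ∀ {n} (t : Term n) → subᵗ var t ≡ t
subᵗ-id (var i)  = refl
subᵗ-id 0ᵗ       = refl
subᵗ-id (sᵗ t)   = cong sᵗ (subᵗ-id t)
subᵗ-id (t +ᵗ u) = cong₂ _+ᵗ_ (subᵗ-id t) (subᵗ-id u)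
subᵗ-id (t ×ᵗ u) = cong₂ _×ᵗ_ (subᵗ-id t) (subᵗ-id u)

renᵗ≡subᵗ : ∀ {m n} (ρ : Fin m → Fin n) t → renᵗ ρ t ≡ subᵗ (var ∘ ρ) t
renᵗ≡subᵗ ρ (var i)  = refl
renᵗ≡subᵗ ρ 0ᵗ       = refl
renᵗ≡subᵗ ρ (sᵗ t)   = cong sᵗ (renᵗ≡subᵗ ρ t)
renᵗ≡subᵗ ρ (t +ᵗ u) = cong₂ _+ᵗ_ (renᵗ≡subᵗ ρ t) (renᵗ≡subᵗ ρ u)
renᵗ≡subᵗ ρ (t ×ᵗ u) = cong₂ _×ᵗ_ (renᵗ≡subᵗ ρ t) (renᵗ≡subᵗ ρ u)

subᵗ-subᵗ : ∀ {l m n} (τ : Fin m → Term n) (σ : Fin l → Term m) t →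
            subᵗ τ (subᵗ σ t) ≡ subᵗ (subᵗ τ ∘ σ) t
subᵗ-subᵗ τ σ (var i)  = refl
subᵗ-subᵗ τ σ 0ᵗ       = refl
subᵗ-subᵗ τ σ (sᵗ t)   = cong sᵗ (subᵗ-subᵗ τ σ t)
subᵗ-subᵗ τ σ (t +ᵗ u) = cong₂ _+ᵗ_ (subᵗ-subᵗ τ σ t) (subᵗ-subᵗ τ σ u)
subᵗ-subᵗ τ σ (t ×ᵗ u) = cong₂ _×ᵗ_ (subᵗ-subᵗ τ σ t) (subᵗ-subᵗ τ σ u)

subᵗ-wkᵗ : ∀ {m n} (σ : Fin (suc m) → Term n) t → subᵗ σ (wkᵗ t) ≡ subᵗ (σ ∘ suc) t
subᵗ-wkᵗ σ t = trans (cong (subᵗ σ) (renᵗ≡subᵗ suc t)) (subᵗ-subᵗ σ (var ∘ suc) t)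

wkᵗ-subᵗ : ∀ {m n} (σ : Fin m → Term n) t → wkᵗ (subᵗ σ t) ≡ subᵗ (wkᵗ ∘ σ) t
wkᵗ-subᵗ σ t = trans (renᵗ≡subᵗ suc (subᵗ σ t))
  (trans (subᵗ-subᵗ (var ∘ suc) σ t) (subᵗ-cong (λ i → sym (renᵗ≡subᵗ suc (σ i))) t))

subᵗ-lift-wkᵗ : ∀ {m n} (σ : Fin m → Term n) t → subᵗ (lift σ) (wkᵗ t) ≡ wkᵗ (subᵗ σ t)
subᵗ-lift-wkᵗ σ t = trans (subᵗ-wkᵗ (lift σ) t) (sym (wkᵗ-subᵗ σ t))

subᵗ-inst-wkᵗ : ∀ {n} (u t : Term n) → subᵗ (inst u) (wkᵗ t) ≡ t
subᵗ-inst-wkᵗ u t = trans (subᵗ-wkᵗ (inst u) t) (subᵗ-id t)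

lift-cong : ∀ {m n} {σ τ : Fin m → Term n} → (∀ i → σ i ≡ τ i) → ∀ i → lift σ i ≡ lift τ i
lift-cong e zero    = refl
lift-cong e (suc i) = cong wkᵗ (e i)

sub-cong : ∀ {m n} {σ τ : Fin m → Term n} → (∀ i → σ i ≡ τ i) → ∀ φ → sub σ φ ≡ sub τ φ
sub-cong e (t ≐ u)  = cong₂ _≐_ (subᵗ-cong e t) (subᵗ-cong e u)
sub-cong e (t ≤ᶠ u) = cong₂ _≤ᶠ_ (subᵗ-cong e t) (subᵗ-cong e u)
sub-cong e ⊥ᶠ       = refl
sub-cong e (φ ⇒ ψ)  = cong₂ _⇒_ (sub-cong e φ) (sub-cong e ψ)
sub-cong e (φ ∧ᶠ ψ) = cong₂ _∧ᶠ_ (sub-cong e φ) (sub-cong e ψ)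
sub-cong e (φ ∨ᶠ ψ) = cong₂ _∨ᶠ_ (sub-cong e φ) (sub-cong e ψ)
sub-cong e (∀ᶠ φ)   = cong ∀ᶠ_ (sub-cong (lift-cong e) φ)
sub-cong e (∃ᶠ φ)   = cong ∃ᶠ_ (sub-cong (lift-cong e) φ)

lift-id : ∀ {n} {σ : Fin n → Term n} → (∀ i → σ i ≡ var i) → ∀ i → lift σ i ≡ var i
lift-id e zero    = refl
lift-id e (suc i) = cong wkᵗ (e i)

sub-id : ∀ {n} {σ : Fin n → Term n} → (∀ i → σ i ≡ var i) → ∀ φ → sub σ φ ≡ φ
sub-id e (t ≐ u)  = cong₂ _≐_ (trans (subᵗ-cong e t) (subᵗ-id t)) (trans (subᵗ-cong e u) (subᵗ-id u))
sub-id e (t ≤ᶠ u) = cong₂ _≤ᶠ_ (trans (subᵗ-cong e t) (subᵗ-id t)) (trans (subᵗ-cong e u) (subᵗ-id u))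
sub-id e ⊥ᶠ       = refl
sub-id e (φ ⇒ ψ)  = cong₂ _⇒_ (sub-id e φ) (sub-id e ψ)
sub-id e (φ ∧ᶠ ψ) = cong₂ _∧ᶠ_ (sub-id e φ) (sub-id e ψ)
sub-id e (φ ∨ᶠ ψ) = cong₂ _∨ᶠ_ (sub-id e φ) (sub-id e ψ)
sub-id e (∀ᶠ φ)   = cong ∀ᶠ_ (sub-id (lift-id e) φ)
sub-id e (∃ᶠ φ)   = cong ∃ᶠ_ (sub-id (lift-id e) φ)

-- Substitutions are functions and compose only pointwise. With the composite `ρ` as a parameter,
-- `lift ρ` can be taken under a binder, although it is not definitionally the composite of the
-- lifts.
Fuses : ∀ {l m n} → (Fin m → Term n) → (Fin l → Term m) → (Fin l → Term n) → Set
Fuses τ σ ρ = ∀ i → subᵗ τ (σ i) ≡ ρ i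

lift-fuses : ∀ {l m n} {τ : Fin m → Term n} {σ : Fin l → Term m} {ρ} →
             Fuses τ σ ρ → Fuses (lift τ) (lift σ) (lift ρ)
lift-fuses e zero = refl
lift-fuses {τ = τ} {σ} e (suc i) = trans (subᵗ-lift-wkᵗ τ (σ i)) (cong wkᵗ (e i))

subᵗ-fuse : ∀ {l m n} {τ : Fin m → Term n} {σ : Fin l → Term m} {ρ} →
            Fuses τ σ ρ → ∀ t → subᵗ τ (subᵗ σ t) ≡ subᵗ ρ t
subᵗ-fuse {τ = τ} {σ} e t = trans (subᵗ-subᵗ τ σ t) (subᵗ-cong e t)

sub-fuse : ∀ {l m n} {τ : Fin m → Term n} {σ : Fin l → Term m} {ρ} →
           Fuses τ σ ρ → ∀ φ → sub τ (sub σ φ) ≡ sub ρ φ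
sub-fuse e (t ≐ u)  = cong₂ _≐_ (subᵗ-fuse e t) (subᵗ-fuse e u)
sub-fuse e (t ≤ᶠ u) = cong₂ _≤ᶠ_ (subᵗ-fuse e t) (subᵗ-fuse e u)
sub-fuse e ⊥ᶠ       = refl
sub-fuse e (φ ⇒ ψ)  = cong₂ _⇒_ (sub-fuse e φ) (sub-fuse e ψ)
sub-fuse e (φ ∧ᶠ ψ) = cong₂ _∧ᶠ_ (sub-fuse e φ) (sub-fuse e ψ)
sub-fuse e (φ ∨ᶠ ψ) = cong₂ _∨ᶠ_ (sub-fuse e φ) (sub-fuse e ψ)
sub-fuse e (∀ᶠ φ)   = cong ∀ᶠ_ (sub-fuse (lift-fuses e) φ)
sub-fuse e (∃ᶠ φ)   = cong ∃ᶠ_ (sub-fuse (lift-fuses e) φ)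

sub-sub : ∀ {l m n} (τ : Fin m → Term n) (σ : Fin l → Term m) φ →
          sub τ (sub σ φ) ≡ sub (subᵗ τ ∘ σ) φ
sub-sub τ σ = sub-fuse (λ _ → refl)

sub-swap : ∀ {l m m′ n} {τ : Fin m → Term n} {σ : Fin l → Term m}
           {τ′ : Fin m′ → Term n} {σ′ : Fin l → Term m′} →
           (∀ i → subᵗ τ (σ i) ≡ subᵗ τ′ (σ′ i)) → ∀ φ → sub τ (sub σ φ) ≡ sub τ′ (sub σ′ φ)
sub-swap {τ′ = τ′} {σ′} e φ = trans (sub-fuse e φ) (sym (sub-sub τ′ σ′ φ))

sub-lift-wk : ∀ {m n} (σ : Fin m → Term n) φ → sub (lift σ) (wk φ) ≡ wk (sub σ φ)
sub-lift-wk σ = sub-swap (λ i → renᵗ≡subᵗ suc (σ i))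

sub-[] : ∀ {m n} (σ : Fin m → Term n) φ t → sub σ (φ [ t ]) ≡ sub (lift σ) φ [ subᵗ σ t ]
sub-[] σ φ t = sub-swap (λ { zero → refl ; (suc i) → sym (subᵗ-inst-wkᵗ (subᵗ σ t) (σ i)) }) φ

wk-[] : ∀ {n} (φ : Formula n) t → wk φ [ t ] ≡ φ
wk-[] φ t = trans (sub-sub (inst t) (var ∘ suc) φ) (sub-id (λ _ → refl) φ)

sub-lift-suc-[x₀] : ∀ {n} (φ : Formula (suc n)) → sub (lift (var ∘ suc)) φ [ x₀ ] ≡ φ
sub-lift-suc-[x₀] φ = trans (sub-sub (inst x₀) (lift (var ∘ suc)) φ) (sub-id (λ { zero → refl ; (suc i) → refl }) φ)

sub-⟨⟩ : ∀ {m n} (σ : Fin m → Term n) φ t → sub σ (φ ⟨ t ⟩) ≡ φ ⟨ subᵗ σ t ⟩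
sub-⟨⟩ σ φ t = sub-sub σ (const t) φ

x₂ : ∀ {n} → Term (suc (suc (suc n)))
x₂ = var (suc (suc zero))

x₃ : ∀ {n} → Term (suc (suc (suc (suc n))))
x₃ = var (suc (suc (suc zero)))

renᵗ-renᵗ : ∀ {l m n} (ρ : Fin m → Fin n) (ρ′ : Fin l → Fin m) t → renᵗ ρ (renᵗ ρ′ t) ≡ renᵗ (ρ ∘ ρ′) t
renᵗ-renᵗ ρ ρ′ (var i)  = refl
renᵗ-renᵗ ρ ρ′ 0ᵗ       = refl
renᵗ-renᵗ ρ ρ′ (sᵗ t)   = cong sᵗ (renᵗ-renᵗ ρ ρ′ t)
renᵗ-renᵗ ρ ρ′ (t +ᵗ u) = cong₂ _+ᵗ_ (renᵗ-renᵗ ρ ρ′ t) (renᵗ-renᵗ ρ ρ′ u)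
renᵗ-renᵗ ρ ρ′ (t ×ᵗ u) = cong₂ _×ᵗ_ (renᵗ-renᵗ ρ ρ′ t) (renᵗ-renᵗ ρ ρ′ u)

-- Natural deduction

private variable
  n : ℕ
  U : Theory
  Γ : List (Formula n)

cast : ∀ {φ ψ : Formula n} → φ ≡ ψ → U ∣ Γ ⊢ φ → U ∣ Γ ⊢ ψ
cast refl d = d

-- An inclusion of contexts in place of `Δ = map (sub σ) Γ` lets one induction give both
-- substitution and, with `σ = var`, weakening.
sub-⊢ : ∀ {m n} {Γ : List (Formula m)} {Δ : List (Formula n)} {φ} (σ : Fin m → Term n) →
        (∀ {ψ} → ψ ∈ Γ → sub σ ψ ∈ Δ) → U ∣ Γ ⊢ φ → U ∣ Δ ⊢ sub σ φ
lift-∈ : ∀ {m n} {Γ : List (Formula m)} {Δ : List (Formula n)} (σ : Fin m → Term n) →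
         (∀ {ψ} → ψ ∈ Γ → sub σ ψ ∈ Δ) → ∀ {ψ} → ψ ∈ map wk Γ → sub (lift σ) ψ ∈ map wk Δ
lift-∈ σ ρ ψ∈ with ψ′ , ψ′∈ , refl ← ∈-map⁻ wk ψ∈ =
  subst (_∈ _) (sym (sub-lift-wk σ ψ′)) (∈-map⁺ wk (ρ ψ′∈))

∷-∈ : ∀ {m n} {Γ : List (Formula m)} {Δ : List (Formula n)} {χ} (σ : Fin m → Term n) →
      (∀ {ψ} → ψ ∈ Γ → sub σ ψ ∈ Δ) → ∀ {ψ} → ψ ∈ χ ∷ Γ → sub σ ψ ∈ sub σ χ ∷ Δ
∷-∈ σ ρ (here refl) = here refl
∷-∈ σ ρ (there p)   = there (ρ p)

sub-⊢ σ ρ (ax {σ = χ} a) = cast (sym (sub-fuse (λ ()) χ)) (ax a)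
sub-⊢ σ ρ (hyp p)        = hyp (ρ p)
sub-⊢ σ ρ (raa d)        = raa (sub-⊢ σ (∷-∈ σ ρ) d)
sub-⊢ σ ρ (⇒I d)         = ⇒I (sub-⊢ σ (∷-∈ σ ρ) d)
sub-⊢ σ ρ (⇒E d e)       = ⇒E (sub-⊢ σ ρ d) (sub-⊢ σ ρ e)
sub-⊢ σ ρ (∧I d e)       = ∧I (sub-⊢ σ ρ d) (sub-⊢ σ ρ e)
sub-⊢ σ ρ (∧E₁ d)        = ∧E₁ (sub-⊢ σ ρ d)
sub-⊢ σ ρ (∧E₂ d)        = ∧E₂ (sub-⊢ σ ρ d)
sub-⊢ σ ρ (∨I₁ d)        = ∨I₁ (sub-⊢ σ ρ d)
sub-⊢ σ ρ (∨I₂ d)        = ∨I₂ (sub-⊢ σ ρ d)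
sub-⊢ σ ρ (∨E d e f)     = ∨E (sub-⊢ σ ρ d) (sub-⊢ σ (∷-∈ σ ρ) e) (sub-⊢ σ (∷-∈ σ ρ) f)
sub-⊢ σ ρ (∀I d)         = ∀I (sub-⊢ (lift σ) (lift-∈ σ ρ) d)
sub-⊢ σ ρ (∀E {φ = φ} d t) = cast (sym (sub-[] σ φ t)) (∀E (sub-⊢ σ ρ d) (subᵗ σ t))
sub-⊢ σ ρ (∃I {φ = φ} t d) = ∃I (subᵗ σ t) (cast (sub-[] σ φ t) (sub-⊢ σ ρ d))
sub-⊢ σ ρ (∃E {χ = χ} d e) = ∃E (sub-⊢ σ ρ d)
  (cast (sub-lift-wk σ χ) (sub-⊢ (lift σ) (∷-∈ (lift σ) (lift-∈ σ ρ)) e))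
sub-⊢ σ ρ (=I t)         = =I (subᵗ σ t)
sub-⊢ σ ρ (=E {t = t} {u} φ d e) = cast (sym (sub-[] σ φ u))
  (=E (sub (lift σ) φ) (sub-⊢ σ ρ d) (cast (sub-[] σ φ t) (sub-⊢ σ ρ e)))

weaken : ∀ {Γ Δ : List (Formula n)} {φ} → (∀ {ψ} → ψ ∈ Γ → ψ ∈ Δ) → U ∣ Γ ⊢ φ → U ∣ Δ ⊢ φ
weaken {φ = φ} ρ d = cast (sub-id (λ _ → refl) φ)
  (sub-⊢ var (λ {ψ} p → subst (_∈ _) (sym (sub-id (λ _ → refl) ψ)) (ρ p)) d)

weaken₀ : ∀ {φ : Formula n} → U ⊢ φ → U ∣ Γ ⊢ φ
weaken₀ = weaken λ ()

-- Facts about terms are first proved for de Bruijn variables, where `wkᵗ`, `lift` and `inst`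
-- compute, and then carried over to arbitrary terms.
instantiate : ∀ {m} {φ : Formula m} → U ⊢ φ → (ts : Vec (Term n) m) → U ∣ Γ ⊢ sub (lookup ts) φ
instantiate d ts = sub-⊢ (lookup ts) (λ ()) d

cut : ∀ {φ ψ : Formula n} → U ∣ φ ∷ [] ⊢ ψ → U ∣ Γ ⊢ φ → U ∣ Γ ⊢ ψ
cut d = ⇒E (weaken₀ (⇒I d))

h₀ : ∀ {φ : Formula n} → U ∣ φ ∷ Γ ⊢ φ
h₀ = hyp (here refl)

h₁ : ∀ {φ ψ : Formula n} → U ∣ ψ ∷ φ ∷ Γ ⊢ φ
h₁ = hyp (there (here refl))

h₂ : ∀ {φ ψ χ : Formula n} → U ∣ χ ∷ ψ ∷ φ ∷ Γ ⊢ φ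
h₂ = hyp (there (there (here refl)))

ex-falso : ∀ {φ : Formula n} → U ∣ Γ ⊢ ⊥ᶠ → U ∣ Γ ⊢ φ
ex-falso d = raa (weaken there d)

excluded-middle : ∀ (φ : Formula n) → U ∣ Γ ⊢ φ ∨ᶠ ¬ᶠ φ
excluded-middle φ = raa (⇒E h₀ (∨I₂ (⇒I (⇒E h₁ (∨I₁ h₀)))))

⇔I : ∀ {φ ψ : Formula n} → U ∣ φ ∷ Γ ⊢ ψ → U ∣ ψ ∷ Γ ⊢ φ → U ∣ Γ ⊢ φ ⇔ ψ
⇔I d e = ∧I (⇒I d) (⇒I e)

⇔E₁ : ∀ {φ ψ : Formula n} → U ∣ Γ ⊢ φ ⇔ ψ → U ∣ Γ ⊢ φ → U ∣ Γ ⊢ ψ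
⇔E₁ d = ⇒E (∧E₁ d)

⇔E₂ : ∀ {φ ψ : Formula n} → U ∣ Γ ⊢ φ ⇔ ψ → U ∣ Γ ⊢ ψ → U ∣ Γ ⊢ φ
⇔E₂ d = ⇒E (∧E₂ d)

⇔-sym : ∀ {φ ψ : Formula n} → U ∣ Γ ⊢ φ ⇔ ψ → U ∣ Γ ⊢ ψ ⇔ φ
⇔-sym d = ∧I (∧E₂ d) (∧E₁ d)

⇔-trans : ∀ {φ ψ χ : Formula n} → U ∣ Γ ⊢ φ ⇔ ψ → U ∣ Γ ⊢ ψ ⇔ χ → U ∣ Γ ⊢ φ ⇔ χ
⇔-trans d e = ⇔I (⇔E₁ (weaken there e) (⇔E₁ (weaken there d) h₀))
                 (⇔E₂ (weaken there d) (⇔E₂ (weaken there e) h₀))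

∧-⇔ : ∀ {φ ψ χ : Formula n} → U ∣ φ ∷ Γ ⊢ ψ ⇔ χ → U ∣ Γ ⊢ φ ∧ᶠ ψ ⇔ φ ∧ᶠ χ
∧-⇔ d = ⇔I (∧I (∧E₁ h₀) (⇔E₁ (⇒E (weaken there (⇒I d)) (∧E₁ h₀)) (∧E₂ h₀)))
           (∧I (∧E₁ h₀) (⇔E₂ (⇒E (weaken there (⇒I d)) (∧E₁ h₀)) (∧E₂ h₀)))

∧-⇔ˡ : ∀ {φ ψ χ : Formula n} → U ∣ Γ ⊢ φ ⇔ ψ → U ∣ Γ ⊢ φ ∧ᶠ χ ⇔ ψ ∧ᶠ χ
∧-⇔ˡ d = ⇔I (∧I (⇔E₁ (weaken there d) (∧E₁ h₀)) (∧E₂ h₀))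
            (∧I (⇔E₂ (weaken there d) (∧E₁ h₀)) (∧E₂ h₀))

∧-absorb : ∀ {φ ψ : Formula n} → U ∣ φ ∷ Γ ⊢ φ ∧ᶠ ψ ⇔ ψ
∧-absorb = ⇔I (∧E₂ h₀) (∧I h₁ h₀)

-- Relativising formulas have closure lemmas for ∧, ∨ and ∃ but none for ⇒ or ¬. This and the
-- following equivalences push negations down to the atoms of a Δ₀ formula.
⇒⇔¬∨ : ∀ {φ ψ : Formula n} → U ∣ Γ ⊢ (φ ⇒ ψ) ⇔ (¬ᶠ φ) ∨ᶠ ψ
⇒⇔¬∨ {φ = φ} = ⇔I (∨E (excluded-middle φ) (∨I₂ (⇒E h₁ h₀)) (∨I₁ h₀))
                  (⇒I (∨E h₁ (ex-falso (⇒E h₀ h₁)) h₀))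

¬⇒⇔∧¬ : ∀ {φ ψ : Formula n} → U ∣ Γ ⊢ ¬ᶠ (φ ⇒ ψ) ⇔ φ ∧ᶠ (¬ᶠ ψ)
¬⇒⇔∧¬ = ⇔I (∧I (raa (⇒E h₁ (⇒I (ex-falso (⇒E h₁ h₀))))) (⇒I (⇒E h₁ (⇒I h₁))))
           (⇒I (⇒E (∧E₂ h₁) (⇒E h₀ (∧E₁ h₁))))

¬∧⇔¬∨¬ : ∀ {φ ψ : Formula n} → U ∣ Γ ⊢ ¬ᶠ (φ ∧ᶠ ψ) ⇔ (¬ᶠ φ) ∨ᶠ (¬ᶠ ψ)
¬∧⇔¬∨¬ {φ = φ} = ⇔I (∨E (excluded-middle φ) (∨I₂ (⇒I (⇒E h₂ (∧I h₁ h₀)))) (∨I₁ h₀))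
                    (⇒I (∨E h₁ (⇒E h₀ (∧E₁ h₁)) (⇒E h₀ (∧E₂ h₁))))

¬∨⇔¬∧¬ : ∀ {φ ψ : Formula n} → U ∣ Γ ⊢ ¬ᶠ (φ ∨ᶠ ψ) ⇔ (¬ᶠ φ) ∧ᶠ (¬ᶠ ψ)
¬∨⇔¬∧¬ = ⇔I (∧I (⇒I (⇒E h₁ (∨I₁ h₀))) (⇒I (⇒E h₁ (∨I₂ h₀))))
            (⇒I (∨E h₀ (⇒E (∧E₁ h₂) h₀) (⇒E (∧E₂ h₂) h₀)))

∀E-x₀ : ∀ {φ : Formula (suc n)} {Γ} → U ∣ Γ ⊢ wk (∀ᶠ φ) → U ∣ Γ ⊢ φ
∀E-x₀ {φ = φ} d = cast (sub-lift-suc-[x₀] φ) (∀E d x₀)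

∃I-x₀ : ∀ {φ : Formula (suc n)} {Γ} → U ∣ Γ ⊢ φ → U ∣ Γ ⊢ wk (∃ᶠ φ)
∃I-x₀ {φ = φ} d = ∃I x₀ (cast (sym (sub-lift-suc-[x₀] φ)) d)

¬∀⇔∃¬ : ∀ {φ ψ : Formula (suc n)} → U ∣ Γ ⊢ ¬ᶠ (∀ᶠ (φ ⇒ ψ)) ⇔ ∃ᶠ (φ ∧ᶠ (¬ᶠ ψ))
¬∀⇔∃¬ = ⇔I (raa (⇒E h₁ (∀I (⇒I (raa (⇒E h₂ (∃I-x₀ (∧I h₁ h₀))))))))
           (⇒I (∃E h₁ (⇒E (∧E₂ h₀) (⇒E (∀E-x₀ h₁) (∧E₁ h₀)))))

¬∃⇔∀¬ : ∀ {φ ψ : Formula (suc n)} → U ∣ Γ ⊢ ¬ᶠ (∃ᶠ (φ ∧ᶠ ψ)) ⇔ ∀ᶠ (φ ⇒ ¬ᶠ ψ)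
¬∃⇔∀¬ = ⇔I (∀I (⇒I (⇒I (⇒E h₂ (∃I-x₀ (∧I h₁ h₀))))))
           (⇒I (∃E h₀ (⇒E (⇒E (∀E-x₀ h₂) (∧E₁ h₀)) (∧E₂ h₀))))

∀E₀ : ∀ {φ : Formula (suc n)} → U ⊢ ∀ᶠ φ → U ⊢ φ
∀E₀ d = ∀E-x₀ (sub-⊢ (var ∘ suc) (λ ()) d)

∀^I : ∀ k {φ : Formula (k + n)} → U ⊢ φ → U ⊢ ∀^ k φ
∀^I zero    d = d
∀^I (suc k) d = ∀^I k (∀I d)

∀^E : ∀ k {φ : Formula (k + n)} → U ⊢ ∀^ k φ → U ⊢ φ
∀^E zero    d = d
∀^E (suc k) d = ∀E₀ (∀^E k d)

≐-sym : ∀ {t u : Term n} → U ∣ Γ ⊢ t ≐ u → U ∣ Γ ⊢ u ≐ t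
≐-sym {t = t} {u} = ⇒E (instantiate {φ = x₀ ≐ x₁ ⇒ x₁ ≐ x₀}
  (⇒I (=E {t = x₀} {x₁} (x₀ ≐ x₁) h₀ (=I _))) (t ∷ u ∷ []))

≐-trans : ∀ {t u v : Term n} → U ∣ Γ ⊢ t ≐ u → U ∣ Γ ⊢ u ≐ v → U ∣ Γ ⊢ t ≐ v
≐-trans {t = t} {u} {v} d e = ⇒E (⇒E (instantiate {φ = x₀ ≐ x₁ ⇒ x₁ ≐ x₂ ⇒ x₀ ≐ x₂}
  (⇒I (⇒I (=E {t = x₁} {x₂} (x₁ ≐ x₀) h₀ h₁))) (t ∷ u ∷ v ∷ [])) d) e

s-cong : ∀ {t u : Term n} → U ∣ Γ ⊢ t ≐ u → U ∣ Γ ⊢ sᵗ t ≐ sᵗ u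
s-cong {t = t} {u} = ⇒E (instantiate {φ = x₀ ≐ x₁ ⇒ sᵗ x₀ ≐ sᵗ x₁}
  (⇒I (=E {t = x₀} {x₁} (sᵗ x₁ ≐ sᵗ x₀) h₀ (=I _))) (t ∷ u ∷ []))

+-cong : ∀ {t t′ u u′ : Term n} → U ∣ Γ ⊢ t ≐ t′ → U ∣ Γ ⊢ u ≐ u′ → U ∣ Γ ⊢ t +ᵗ u ≐ t′ +ᵗ u′
+-cong {t = t} {t′} {u} {u′} d e = ⇒E (⇒E (instantiate {φ = x₀ ≐ x₁ ⇒ x₂ ≐ x₃ ⇒ x₀ +ᵗ x₂ ≐ x₁ +ᵗ x₃}
  (⇒I (⇒I (=E {t = x₂} {x₃} (x₁ +ᵗ x₃ ≐ x₂ +ᵗ x₀) h₀ (=E {t = x₀} {x₁} (x₁ +ᵗ x₃ ≐ x₀ +ᵗ x₃) h₁ (=I _)))))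
  (t ∷ t′ ∷ u ∷ u′ ∷ [])) d) e

×-cong : ∀ {t t′ u u′ : Term n} → U ∣ Γ ⊢ t ≐ t′ → U ∣ Γ ⊢ u ≐ u′ → U ∣ Γ ⊢ t ×ᵗ u ≐ t′ ×ᵗ u′
×-cong {t = t} {t′} {u} {u′} d e = ⇒E (⇒E (instantiate {φ = x₀ ≐ x₁ ⇒ x₂ ≐ x₃ ⇒ x₀ ×ᵗ x₂ ≐ x₁ ×ᵗ x₃}
  (⇒I (⇒I (=E {t = x₂} {x₃} (x₁ ×ᵗ x₃ ≐ x₂ ×ᵗ x₀) h₀ (=E {t = x₀} {x₁} (x₁ ×ᵗ x₃ ≐ x₀ ×ᵗ x₃) h₁ (=I _)))))
  (t ∷ t′ ∷ u ∷ u′ ∷ [])) d) e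

Leibniz : ∀ (φ : Formula (suc n)) {t u} → U ∣ Γ ⊢ t ≐ u → U ∣ Γ ⊢ φ [ t ] ⇔ φ [ u ]
Leibniz φ d = ⇔I (=E φ (weaken there d) h₀) (=E φ (≐-sym (weaken there d)) h₀)

Leibniz-⟨⟩ : ∀ (φ : Formula 1) {t u : Term n} → U ∣ Γ ⊢ t ≐ u → U ∣ Γ ⊢ φ ⟨ t ⟩ ⇔ φ ⟨ u ⟩
Leibniz-⟨⟩ φ {t} {u} d = cast (cong₂ _⇔_ (sub-⟨⟩ (inst t) φ x₀) (sub-⟨⟩ (inst u) φ x₀)) (Leibniz (φ ⟨ x₀ ⟩) d)

Leibniz-x₀ : ∀ (φ : Formula (suc n)) {Γ} t → U ∣ Γ ⊢ x₀ ≐ wkᵗ t → U ∣ Γ ⊢ φ ⇔ wk (φ [ t ])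
Leibniz-x₀ φ t d = cast (cong₂ _⇔_ (sub-lift-suc-[x₀] φ) (trans (cong (sub (lift (var ∘ suc)) φ [_]) (renᵗ≡subᵗ suc t)) (sym (sub-[] (var ∘ suc) φ t))))
  (Leibniz (sub (lift (var ∘ suc)) φ) d)

-- Since ∃x (x = t) is provable, a fresh variable may serve as a name for `t`; compound terms are
-- unnested this way.
let-∃ : ∀ {χ : Formula n} t → U ∣ (x₀ ≐ wkᵗ t) ∷ map wk Γ ⊢ wk χ → U ∣ Γ ⊢ χ
let-∃ t = ∃E (∃I t (cast (cong (t ≐_) (sym (subᵗ-inst-wkᵗ t t))) (=I t)))

extend : PA ≼ U → ∀ {Γ : List (Formula n)} {φ} → PA ∣ Γ ⊢ φ → U ∣ Γ ⊢ φ
extend pa {[]}    d = pa _ d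
extend pa {ψ ∷ Γ} d = ⇒E (weaken there (extend pa (⇒I d))) h₀

-- Arithmetic

+ᵗ-0 : ∀ (a : Term n) → PA ∣ Γ ⊢ a +ᵗ 0ᵗ ≐ a
+ᵗ-0 a = instantiate {φ = x₀ +ᵗ 0ᵗ ≐ x₀} (∀E (ax +-0) x₀) (a ∷ [])

+ᵗ-s : ∀ (a b : Term n) → PA ∣ Γ ⊢ a +ᵗ sᵗ b ≐ sᵗ (a +ᵗ b)
+ᵗ-s a b = instantiate {φ = x₀ +ᵗ sᵗ x₁ ≐ sᵗ (x₀ +ᵗ x₁)} (∀E (∀E (ax +-s) x₀) x₁) (a ∷ b ∷ [])

×ᵗ-0 : ∀ (a : Term n) → PA ∣ Γ ⊢ a ×ᵗ 0ᵗ ≐ 0ᵗ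
×ᵗ-0 a = instantiate {φ = x₀ ×ᵗ 0ᵗ ≐ 0ᵗ} (∀E (ax ×-0) x₀) (a ∷ [])

×ᵗ-s : ∀ (a b : Term n) → PA ∣ Γ ⊢ a ×ᵗ sᵗ b ≐ a ×ᵗ b +ᵗ a
×ᵗ-s a b = instantiate {φ = x₀ ×ᵗ sᵗ x₁ ≐ x₀ ×ᵗ x₁ +ᵗ x₀} (∀E (∀E (ax ×-s) x₀) x₁) (a ∷ b ∷ [])

sᵗ-injective : ∀ {a b : Term n} → PA ∣ Γ ⊢ sᵗ a ≐ sᵗ b → PA ∣ Γ ⊢ a ≐ b
sᵗ-injective {a = a} {b} = ⇒E (instantiate {φ = sᵗ x₀ ≐ sᵗ x₁ ⇒ x₀ ≐ x₁} (∀E (∀E (ax s-inj) x₀) x₁) (a ∷ b ∷ []))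

sᵗ≢0 : ∀ (a : Term n) {φ} → PA ∣ Γ ⊢ sᵗ a ≐ 0ᵗ → PA ∣ Γ ⊢ φ
sᵗ≢0 a d = ex-falso (⇒E (instantiate {φ = ¬ᶠ (sᵗ x₀ ≐ 0ᵗ)} (∀E (ax s≠0) x₀) (a ∷ [])) d)

≤⇔∃ : ∀ (a b : Term n) → PA ∣ Γ ⊢ a ≤ᶠ b ⇔ ∃ᶠ (x₀ +ᵗ wkᵗ a ≐ wkᵗ b)
≤⇔∃ a b = instantiate {φ = x₀ ≤ᶠ x₁ ⇔ ∃ᶠ (x₀ +ᵗ x₁ ≐ x₂)} (∀E (∀E (ax ≤-def) x₀) x₁) (a ∷ b ∷ [])

PA-ind : ∀ {m} (φ : Formula (suc m)) → PA ⊢ φ [ 0ᵗ ] ∧ᶠ (∀ᶠ (φ ⇒ sub s-at₀ φ)) ⇒ ∀ᶠ φ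
PA-ind {m} = subst (λ k → ∀ (φ : Formula (suc k)) → PA ⊢ φ [ 0ᵗ ] ∧ᶠ (∀ᶠ (φ ⇒ sub s-at₀ φ)) ⇒ ∀ᶠ φ) (+-identityʳ m)
  (λ φ → ∀^E m (cast (sub-id (λ ()) _) (ax (ind m φ))))

induct : PA ≼ U → ∀ (φ : Formula (suc n)) → U ⊢ φ [ 0ᵗ ] → U ∣ φ ∷ [] ⊢ sub s-at₀ φ → U ⊢ φ
induct pa φ d e = ∀E₀ (⇒E (pa _ (PA-ind φ)) (∧I d (∀I (⇒I e))))

induct-PA : ∀ (φ : Formula (suc n)) → PA ⊢ φ [ 0ᵗ ] → PA ∣ φ ∷ [] ⊢ sub s-at₀ φ → PA ⊢ φ
induct-PA = induct (λ _ d → d)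

0+ᵗ : ∀ (a : Term n) → PA ∣ Γ ⊢ 0ᵗ +ᵗ a ≐ a
0+ᵗ a = instantiate {φ = 0ᵗ +ᵗ x₀ ≐ x₀}
  (induct-PA _ (+ᵗ-0 _) (≐-trans (+ᵗ-s _ _) (s-cong h₀))) (a ∷ [])

s+ᵗ : ∀ (a b : Term n) → PA ∣ Γ ⊢ sᵗ a +ᵗ b ≐ sᵗ (a +ᵗ b)
s+ᵗ a b = instantiate {φ = sᵗ x₁ +ᵗ x₀ ≐ sᵗ (x₁ +ᵗ x₀)}
  (induct-PA _ (≐-trans (+ᵗ-0 _) (≐-sym (s-cong (+ᵗ-0 _))))
    (≐-trans (+ᵗ-s _ _) (≐-trans (s-cong h₀) (≐-sym (s-cong (+ᵗ-s _ _)))))) (b ∷ a ∷ [])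

+ᵗ-assoc : ∀ (a b c : Term n) → PA ∣ Γ ⊢ (a +ᵗ b) +ᵗ c ≐ a +ᵗ (b +ᵗ c)
+ᵗ-assoc a b c = instantiate {φ = (x₁ +ᵗ x₂) +ᵗ x₀ ≐ x₁ +ᵗ (x₂ +ᵗ x₀)}
  (induct-PA _ (≐-trans (+ᵗ-0 _) (≐-sym (+-cong (=I _) (+ᵗ-0 _))))
    (≐-trans (+ᵗ-s _ _) (≐-trans (s-cong h₀) (≐-sym (≐-trans (+-cong (=I _) (+ᵗ-s _ _)) (+ᵗ-s _ _))))))
  (c ∷ a ∷ b ∷ [])

+ᵗ-cancelʳ : ∀ {a b} (c : Term n) → PA ∣ Γ ⊢ a +ᵗ c ≐ b +ᵗ c → PA ∣ Γ ⊢ a ≐ b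
+ᵗ-cancelʳ {a = a} {b} c = ⇒E (instantiate {φ = x₁ +ᵗ x₀ ≐ x₂ +ᵗ x₀ ⇒ x₁ ≐ x₂}
  (induct-PA _ (⇒I (≐-trans (≐-sym (+ᵗ-0 _)) (≐-trans h₀ (+ᵗ-0 _))))
    (⇒I (⇒E h₁ (sᵗ-injective (≐-trans (≐-sym (+ᵗ-s _ _)) (≐-trans h₀ (+ᵗ-s _ _)))))))
  (c ∷ a ∷ b ∷ []))

s+ᵗ-irrefl : ∀ (a b : Term n) {φ} → PA ∣ Γ ⊢ sᵗ a +ᵗ b ≐ b → PA ∣ Γ ⊢ φ
s+ᵗ-irrefl a b d = sᵗ≢0 a (+ᵗ-cancelʳ b (≐-trans d (≐-sym (0+ᵗ b))))

zero-or-suc : ∀ (a : Term n) → PA ∣ Γ ⊢ (a ≐ 0ᵗ) ∨ᶠ (∃ᶠ (wkᵗ a ≐ sᵗ x₀))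
zero-or-suc a = instantiate {φ = (x₀ ≐ 0ᵗ) ∨ᶠ (∃ᶠ (x₁ ≐ sᵗ x₀))}
  (induct-PA _ (∨I₁ (=I _)) (∨I₂ (∃I x₀ (=I _)))) (a ∷ [])

-- Induction on `a`. In the step, a difference d with d + a = b is either 0, and then s a exceeds b
-- by one, or a successor, whose predecessor is the new difference.
≤-or-> : ∀ (a b : Term n) → PA ∣ Γ ⊢ (∃ᶠ (x₀ +ᵗ wkᵗ a ≐ wkᵗ b)) ∨ᶠ (∃ᶠ (sᵗ x₀ +ᵗ wkᵗ b ≐ wkᵗ a))
≤-or-> a b = instantiate {φ = (∃ᶠ (x₀ +ᵗ x₁ ≐ x₂)) ∨ᶠ (∃ᶠ (sᵗ x₀ +ᵗ x₂ ≐ x₁))}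
  (induct-PA _ (∨I₁ (∃I x₀ (+ᵗ-0 _)))
    (∨E h₀
      (∃E h₀ (∨E (zero-or-suc x₀)
        (∨I₂ (∃I 0ᵗ (≐-trans (s+ᵗ _ _) (s-cong (≐-trans (0+ᵗ _)
          (≐-trans (≐-sym h₁) (≐-trans (+-cong h₀ (=I _)) (0+ᵗ _))))))))
        (∨I₁ (∃E h₀ (∃I x₀ (≐-trans (+ᵗ-s _ _) (≐-trans (≐-sym (s+ᵗ _ _))
          (≐-trans (+-cong (≐-sym h₀) (=I _)) h₂))))))))
      (∃E h₀ (∨I₂ (∃I (sᵗ x₀) (≐-trans (s+ᵗ _ _) (s-cong h₀)))))))
  (a ∷ b ∷ [])

-- Together with `≢⇔∃`, this turns negated atoms into formulas built from equations by ∨ and ∃.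
≰⇔∃ : ∀ (a b : Term n) → PA ∣ Γ ⊢ ¬ᶠ (a ≤ᶠ b) ⇔ ∃ᶠ (sᵗ x₀ +ᵗ wkᵗ b ≐ wkᵗ a)
≰⇔∃ a b = instantiate {φ = ¬ᶠ (x₀ ≤ᶠ x₁) ⇔ ∃ᶠ (sᵗ x₀ +ᵗ x₂ ≐ x₁)}
  (⇔I (∨E (≤-or-> x₀ x₁) (ex-falso (⇒E h₁ (⇔E₂ (≤⇔∃ _ _) h₀))) h₀)
      (⇒I (∃E h₁ (∃E (⇔E₁ (≤⇔∃ _ _) h₁) (s+ᵗ-irrefl _ _
        -- With s d + b = a and e + a = b, this is s(e + d) + b = e + (s d + b) = e + a = b.
        (≐-trans (≐-trans (+-cong (≐-sym (+ᵗ-s _ _)) (=I _)) (+ᵗ-assoc _ _ _)) (≐-trans (+-cong (=I _) h₁) h₀)))))))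
  (a ∷ b ∷ [])

≢⇔∃ : ∀ (a b : Term n) → PA ∣ Γ ⊢ ¬ᶠ (a ≐ b) ⇔
      (∃ᶠ (sᵗ x₀ +ᵗ wkᵗ a ≐ wkᵗ b)) ∨ᶠ (∃ᶠ (sᵗ x₀ +ᵗ wkᵗ b ≐ wkᵗ a))
≢⇔∃ a b = instantiate {φ = ¬ᶠ (x₀ ≐ x₁) ⇔ (∃ᶠ (sᵗ x₀ +ᵗ x₁ ≐ x₂)) ∨ᶠ (∃ᶠ (sᵗ x₀ +ᵗ x₂ ≐ x₁))}
  (⇔I (∨E (≤-or-> x₀ x₁)
        (∃E h₀ (∨E (zero-or-suc x₀)
          (ex-falso (⇒E (hyp (there (there (there (here refl)))))
            (≐-trans (≐-sym (0+ᵗ _)) (≐-trans (+-cong (≐-sym h₀) (=I _)) h₁))))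
          (∨I₁ (∃E h₀ (∃I x₀ (≐-trans (+-cong (≐-sym h₀) (=I _)) h₂))))))
        (∨I₂ h₀))
      (⇒I (∨E h₁
        (∃E h₀ (s+ᵗ-irrefl _ _ (≐-trans h₀ (≐-sym h₂))))
        (∃E h₀ (s+ᵗ-irrefl _ _ (≐-trans h₀ h₂))))))
  (a ∷ b ∷ [])

numeral-+ : ∀ a b → PA ∣ Γ ⊢ numeral {n} a +ᵗ numeral b ≐ numeral (a + b)
numeral-+ a zero    = cast (cong (λ c → numeral a +ᵗ 0ᵗ ≐ numeral c) (sym (+-identityʳ a))) (+ᵗ-0 _)
numeral-+ a (suc b) = cast (cong (λ c → numeral a +ᵗ numeral (suc b) ≐ numeral c) (sym (+-suc a b)))
  (≐-trans (+ᵗ-s _ _) (s-cong (numeral-+ a b)))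

numeral-× : ∀ a b → PA ∣ Γ ⊢ numeral {n} a ×ᵗ numeral b ≐ numeral (a * b)
numeral-× a zero    = cast (cong (λ c → numeral a ×ᵗ 0ᵗ ≐ numeral c) (sym (*-zeroʳ a))) (×ᵗ-0 _)
numeral-× a (suc b) = cast (cong (λ c → numeral a ×ᵗ numeral (suc b) ≐ numeral c)
    (trans (+-comm (a * b) a) (sym (*-suc a b))))
  (≐-trans (×ᵗ-s _ _) (≐-trans (+-cong (numeral-× a b) (=I _)) (numeral-+ (a * b) a)))

evaluate : ∀ (a : Fin 0 → ℕ) t → PA ⊢ t ≐ numeral (value a t)
evaluate a 0ᵗ       = =I _
evaluate a (sᵗ t)   = s-cong (evaluate a t)
evaluate a (t +ᵗ u) = ≐-trans (+-cong (evaluate a t) (evaluate a u)) (numeral-+ (value a t) _)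
evaluate a (t ×ᵗ u) = ≐-trans (×-cong (evaluate a t) (evaluate a u)) (numeral-× (value a t) _)

-- Dotted codes

subᵗ-numeral : ∀ {m n} (σ : Fin m → Term n) a → subᵗ σ (numeral a) ≡ numeral a
subᵗ-numeral σ zero    = refl
subᵗ-numeral σ (suc a) = cong sᵗ (subᵗ-numeral σ a)

module _ {m p} (d : Dots m p) where

  sCountᵗ-wkᵗ : ∀ t → sCountᵗ (liftDots d) (wkᵗ t) ≡ sCountᵗ d t
  sCountᵗ-wkᵗ (var i) with d i
  ... | inj₁ _ = refl
  ... | inj₂ _ = refl
  sCountᵗ-wkᵗ 0ᵗ       = refl
  sCountᵗ-wkᵗ (sᵗ t)   = cong sᵗ (sCountᵗ-wkᵗ t)
  sCountᵗ-wkᵗ (_ +ᵗ _) = refl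
  sCountᵗ-wkᵗ (_ ×ᵗ _) = refl

  -- The core of an undotted variable stores its index, which `liftDots` shifts, so cores are not
  -- preserved in general; a vanishing core is.
  coreᵗ-wkᵗ : ∀ t → coreᵗ d t ≡ 0ᵗ → coreᵗ (liftDots d) (wkᵗ t) ≡ 0ᵗ
  coreᵗ-wkᵗ (var i) e with d i
  ... | inj₁ _ = refl
  coreᵗ-wkᵗ (var i) () | inj₂ _
  coreᵗ-wkᵗ 0ᵗ     e = refl
  coreᵗ-wkᵗ (sᵗ t) e = coreᵗ-wkᵗ t e

-- The substitution σ of the coded variables corresponds to the substitution τ
-- of the dotted ones: a dotted variable may only be replaced by a term whose
-- dotted code is that of a numeral.
Compatible : ∀ {m p q} → Dots m q → (Fin p → Term q) → Fin p ⊎ ℕ → Term m → Set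
Compatible d′ τ (inj₁ x) t = sCountᵗ d′ t ≡ τ x × coreᵗ d′ t ≡ 0ᵗ
Compatible d′ τ (inj₂ j) t = ∃ λ v → t ≡ var v × d′ v ≡ inj₂ j

module _ {p q} (τ : Fin p → Term q) where

  lift-compatible : ∀ {m m′} (d : Dots m p) (d′ : Dots m′ q) (σ : Fin m → Term m′) →
    (∀ i → Compatible d′ τ (d i) (σ i)) → ∀ i → Compatible (liftDots d′) τ (liftDots d i) (lift σ i)
  lift-compatible d d′ σ c zero = zero , refl , refl
  lift-compatible d d′ σ c (suc i) with d i | c i
  ... | inj₁ x | e , e′ = trans (sCountᵗ-wkᵗ d′ (σ i)) e , coreᵗ-wkᵗ d′ (σ i) e′
  ... | inj₂ j | v , e , e′ = suc v , cong wkᵗ e , cong (map₂ suc) e′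

  module _ {m m′} (d : Dots m p) (d′ : Dots m′ q) (σ : Fin m → Term m′)
           (c : ∀ i → Compatible d′ τ (d i) (σ i)) where
    mutual
      sub-dotᵗ : ∀ t → subᵗ τ (dotᵗ d t) ≡ dotᵗ d′ (subᵗ σ t)
      sub-dotᵗ t = cong₂ pairᵗ (sub-sCountᵗ t) (sub-coreᵗ t)

      sub-sCountᵗ : ∀ t → subᵗ τ (sCountᵗ d t) ≡ sCountᵗ d′ (subᵗ σ t)
      sub-sCountᵗ (var i) with d i | c i
      ... | inj₁ x | e , _ = sym e
      ... | inj₂ j | v , e , e′ rewrite e | e′ = refl
      sub-sCountᵗ 0ᵗ       = refl
      sub-sCountᵗ (sᵗ t)   = cong sᵗ (sub-sCountᵗ t)
      sub-sCountᵗ (_ +ᵗ _) = refl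
      sub-sCountᵗ (_ ×ᵗ _) = refl

      sub-coreᵗ : ∀ t → subᵗ τ (coreᵗ d t) ≡ coreᵗ d′ (subᵗ σ t)
      sub-coreᵗ (var i) with d i | c i
      ... | inj₁ x | _ , e = sym e
      ... | inj₂ j | v , e , e′ rewrite e | e′ = cong (pairᵗ (numeral 1)) (subᵗ-numeral τ j)
      sub-coreᵗ 0ᵗ       = refl
      sub-coreᵗ (sᵗ t)   = sub-coreᵗ t
      sub-coreᵗ (t +ᵗ u) = cong (pairᵗ (numeral 2)) (cong₂ pairᵗ (sub-dotᵗ t) (sub-dotᵗ u))
      sub-coreᵗ (t ×ᵗ u) = cong (pairᵗ (numeral 3)) (cong₂ pairᵗ (sub-dotᵗ t) (sub-dotᵗ u))

  -- This is an equality of terms, not merely a provable one: `dot` follows the syntax, and a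
  -- compatible `σ` puts for each dotted variable a term with the count prescribed by `τ` and core
  -- 0.
  sub-dot : ∀ {m m′} (d : Dots m p) (d′ : Dots m′ q) (σ : Fin m → Term m′) →
    (∀ i → Compatible d′ τ (d i) (σ i)) → ∀ φ → subᵗ τ (dot d φ) ≡ dot d′ (sub σ φ)
  sub-dot d d′ σ c (t ≐ u)  = cong (pairᵗ (numeral 0)) (cong₂ pairᵗ (sub-dotᵗ d d′ σ c t) (sub-dotᵗ d d′ σ c u))
  sub-dot d d′ σ c (t ≤ᶠ u) = cong (pairᵗ (numeral 1)) (cong₂ pairᵗ (sub-dotᵗ d d′ σ c t) (sub-dotᵗ d d′ σ c u))
  sub-dot d d′ σ c ⊥ᶠ       = refl
  sub-dot d d′ σ c (φ ⇒ ψ)  = cong (pairᵗ (numeral 3)) (cong₂ pairᵗ (sub-dot d d′ σ c φ) (sub-dot d d′ σ c ψ))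
  sub-dot d d′ σ c (φ ∧ᶠ ψ) = cong (pairᵗ (numeral 4)) (cong₂ pairᵗ (sub-dot d d′ σ c φ) (sub-dot d d′ σ c ψ))
  sub-dot d d′ σ c (φ ∨ᶠ ψ) = cong (pairᵗ (numeral 5)) (cong₂ pairᵗ (sub-dot d d′ σ c φ) (sub-dot d d′ σ c ψ))
  sub-dot d d′ σ c (∀ᶠ φ)   = cong (pairᵗ (numeral 6)) (sub-dot (liftDots d) (liftDots d′) (lift σ) (lift-compatible d d′ σ c) φ)
  sub-dot d d′ σ c (∃ᶠ φ)   = cong (pairᵗ (numeral 7)) (sub-dot (liftDots d) (liftDots d′) (lift σ) (lift-compatible d d′ σ c) φ)

allDotted : ∀ {m} → Dots m m
allDotted = inj₁

⌜_⌝˙ : ∀ {m} → Formula m → Term m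
⌜ φ ⌝˙ = dot allDotted φ

⌜∙⌝≡⌜⌝˙ : ∀ k (φ : Formula (k + 0)) → ⌜ k ∙ φ ⌝ ≡ ⌜ φ ⌝˙
⌜∙⌝≡⌜⌝˙ k φ = trans (sym (subᵗ-id _)) (trans
  (sub-dot var (firstDotted k) allDotted var compatible φ) (cong ⌜_⌝˙ (sub-id (λ _ → refl) φ)))
  where
  compatible : ∀ i → Compatible allDotted var (firstDotted k i) (var i)
  compatible i with splitAt k {0} i in e
  ... | inj₁ j = cong var (sym (splitAt⁻¹-↑ˡ e)) , refl

-- These are the terms s...s(x) and s...s(0), which become numerals once their variable does. A sum
-- has a numerical value too, but its code is not that of a numeral, so it cannot be substituted
-- inside a dotted code.
Simpleᵗ : ∀ {n} → Term n → Set
Simpleᵗ t = sCountᵗ allDotted t ≡ t × coreᵗ allDotted t ≡ 0ᵗ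

Simple : ∀ {m n} → (Fin m → Term n) → Set
Simple σ = ∀ i → Simpleᵗ (σ i)

sub-⌜⌝˙ : ∀ {m n} {σ : Fin m → Term n} → Simple σ → ∀ φ → subᵗ σ ⌜ φ ⌝˙ ≡ ⌜ sub σ φ ⌝˙
sub-⌜⌝˙ {σ = σ} = sub-dot σ allDotted allDotted σ

simple-numeral : ∀ a → Simpleᵗ {n} (numeral a)
simple-numeral zero    = refl , refl
simple-numeral (suc a) = cong sᵗ (proj₁ (simple-numeral a)) , proj₂ (simple-numeral a)

simple-lift-suc : ∀ {n} → Simple (lift {n} (var ∘ suc))
simple-lift-suc zero    = refl , refl
simple-lift-suc (suc i) = refl , refl

simple-inst : ∀ {t : Term n} → Simpleᵗ t → Simple (inst t)
simple-inst s zero    = s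
simple-inst s (suc i) = refl , refl

simple-lift-inst-0 : ∀ {n} → Simple (lift {suc n} (inst 0ᵗ))
simple-lift-inst-0 zero          = refl , refl
simple-lift-inst-0 (suc zero)    = refl , refl
simple-lift-inst-0 (suc (suc i)) = refl , refl

simple-lift-s-at₀ : ∀ {n} → Simple (lift (s-at₀ {n}))
simple-lift-s-at₀ zero          = refl , refl
simple-lift-s-at₀ (suc zero)    = refl , refl
simple-lift-s-at₀ (suc (suc i)) = refl , refl

inst₂ : ∀ {n} → Term n → Term n → Fin (suc (suc n)) → Term n
inst₂ t u zero          = t
inst₂ t u (suc zero)    = u
inst₂ t u (suc (suc i)) = var i

-- Bounded quantifiers

≤0⇒≐0 : ∀ {a : Term n} → PA ∣ Γ ⊢ a ≤ᶠ 0ᵗ → PA ∣ Γ ⊢ a ≐ 0ᵗ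
≤0⇒≐0 {a = a} = ⇒E (instantiate {φ = x₀ ≤ᶠ 0ᵗ ⇒ x₀ ≐ 0ᵗ}
  (⇒I (∨E (zero-or-suc x₀) h₀ (∃E h₀ (∃E (⇔E₁ (≤⇔∃ _ _) h₂)
    (sᵗ≢0 (x₀ +ᵗ x₁) (≐-trans (≐-sym (+ᵗ-s _ _)) (≐-trans (+-cong (=I _) (≐-sym h₁)) h₀)))))))
  (a ∷ []))

0≤ : ∀ (a : Term n) → PA ∣ Γ ⊢ 0ᵗ ≤ᶠ a
0≤ a = instantiate {φ = 0ᵗ ≤ᶠ x₀} (⇔E₂ (≤⇔∃ _ _) (∃I x₀ (+ᵗ-0 _))) (a ∷ [])

≤s⇔≤∨≐s : ∀ (a b : Term n) → PA ∣ Γ ⊢ a ≤ᶠ sᵗ b ⇔ (a ≤ᶠ b) ∨ᶠ (a ≐ sᵗ b)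
≤s⇔≤∨≐s a b = instantiate {φ = x₀ ≤ᶠ sᵗ x₁ ⇔ (x₀ ≤ᶠ x₁) ∨ᶠ (x₀ ≐ sᵗ x₁)}
  (⇔I
    (∃E (⇔E₁ (≤⇔∃ _ _) h₀) (∨E (zero-or-suc x₀)
      (∨I₂ (≐-trans (≐-sym (0+ᵗ _)) (≐-trans (+-cong (≐-sym h₀) (=I _)) h₁)))
      (∃E h₀ (∨I₁ (⇔E₂ (≤⇔∃ _ _) (∃I x₀ (sᵗ-injective
        (≐-trans (≐-sym (s+ᵗ _ _)) (≐-trans (+-cong (≐-sym h₀) (=I _)) h₂)))))))))
    (∨E h₀
      (∃E (⇔E₁ (≤⇔∃ _ _) h₀) (⇔E₂ (≤⇔∃ _ _) (∃I (sᵗ x₀) (≐-trans (s+ᵗ _ _) (s-cong h₀)))))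
      (⇔E₂ (≤⇔∃ _ _) (∃I 0ᵗ (≐-trans (0+ᵗ _) h₀)))))
  (a ∷ b ∷ [])

-- With `∀≤s⇔`, this is the recursion on the bound by which bounded ∀ is treated like the graphs of
-- + and ×.
∀≤0⇔ : ∀ (φ : Formula (suc n)) → PA ⊢ ∀ᶠ (x₀ ≤ᶠ 0ᵗ ⇒ φ) ⇔ φ [ 0ᵗ ]
∀≤0⇔ φ = ⇔I (⇒E (∀E h₀ 0ᵗ) (0≤ 0ᵗ)) (∀I (⇒I (⇔E₂ (Leibniz-x₀ φ 0ᵗ (≤0⇒≐0 h₀)) h₁)))

∀≤s⇔ : ∀ (i : Fin n) (φ : Formula (suc n)) →
       PA ⊢ ∀ᶠ (x₀ ≤ᶠ sᵗ (var (suc i)) ⇒ φ) ⇔ (∀ᶠ (x₀ ≤ᶠ var (suc i) ⇒ φ)) ∧ᶠ φ [ sᵗ (var i) ]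
∀≤s⇔ i φ = ⇔I
  (∧I (∀I (⇒I (⇒E (∀E-x₀ h₁) (⇔E₂ (≤s⇔≤∨≐s _ _) (∨I₁ h₀)))))
      (⇒E (∀E h₀ (sᵗ (var i))) (⇔E₂ (≤s⇔≤∨≐s _ _) (∨I₂ (=I _)))))
  (∀I (⇒I (∨E (⇔E₁ (≤s⇔≤∨≐s _ _) h₀)
    (⇒E (∀E-x₀ (∧E₁ h₂)) h₀)
    (⇔E₂ (Leibniz-x₀ φ (sᵗ (var i)) h₀) (∧E₂ h₂)))))

-- The relativised form of Eᵁ

module Relativisation {S T : Theory} {Pr : Formula 1} (PA≼S : PA ≼ S) (PA≼T : PA ≼ T) (eᵁ : Eᵁ S T Pr) where

  private variable
    m : ℕ

  □ : Formula m → Formula m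
  □ φ = Pr ⟨ ⌜ φ ⌝˙ ⟩

  sub-□ : ∀ {m n} {σ : Fin m → Term n} → Simple σ → ∀ φ → sub σ (□ φ) ≡ □ (sub σ φ)
  sub-□ {σ = σ} s φ = trans (sub-⟨⟩ σ Pr ⌜ φ ⌝˙) (cong (Pr ⟨_⟩) (sub-⌜⌝˙ s φ))

  wk-□ : ∀ (φ : Formula m) → wk (□ φ) ≡ □ (wk φ)
  wk-□ = sub-□ (λ _ → refl , refl)

  □-⇔ : ∀ {φ ψ : Formula m} → T ⊢ φ ⇔ ψ → S ∣ Γ ⊢ □ φ ⇔ □ ψ
  □-⇔ {m} {φ = φ} {ψ} d = weaken₀ (□-⇔′ φ ψ d)
    where
    □-⇔′ : ∀ (φ ψ : Formula m) → T ⊢ φ ⇔ ψ → S ⊢ □ φ ⇔ □ ψ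
    □-⇔′ = subst (λ k → ∀ (φ ψ : Formula k) → T ⊢ φ ⇔ ψ → S ⊢ □ φ ⇔ □ ψ) (+-identityʳ m)
      λ φ ψ d → cast (cong₂ (λ t u → Pr ⟨ t ⟩ ⇔ Pr ⟨ u ⟩) (⌜∙⌝≡⌜⌝˙ m φ) (⌜∙⌝≡⌜⌝˙ m ψ))
        (∀^E m (eᵁ m φ ψ (∀^I m d)))

  Relativises : Formula m → Set
  Relativises δ = ∀ {χ χ′} → T ∣ δ ∷ [] ⊢ χ ⇔ χ′ → S ∣ δ ∷ [] ⊢ □ χ ⇔ □ χ′

  relativise : ∀ {δ χ χ′ : Formula m} → Relativises δ → S ∣ Γ ⊢ δ → T ∣ δ ∷ [] ⊢ χ ⇔ χ′ → S ∣ Γ ⊢ □ χ ⇔ □ χ′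
  relativise r d e = cut (r e) d

  relativises-⇔ : ∀ {δ ε : Formula m} → PA ⊢ δ ⇔ ε → Relativises ε → Relativises δ
  relativises-⇔ d r e = relativise r (⇔E₁ (weaken₀ (PA≼S _ d)) h₀) (cut e (⇔E₂ (weaken₀ (PA≼T _ d)) h₀))

  -- The hypothesis `ε` is moved inside □: under it, □χ and □χ′ are equivalent to □(ε ∧ χ) and □(ε ∧
  -- χ′), and from `δ` alone `T` proves ε ∧ χ ↔ ε ∧ χ′.
  relativises-∧ : ∀ {δ ε : Formula m} → Relativises δ → Relativises ε → Relativises (δ ∧ᶠ ε)
  relativises-∧ r r′ e =
    ⇔-trans (⇔-sym (relativise r′ (∧E₂ h₀) ∧-absorb))
      (⇔-trans (relativise r (∧E₁ h₀) (∧-⇔ (cut e (∧I h₁ h₀))))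
        (relativise r′ (∧E₂ h₀) ∧-absorb))

  relativises-∨ : ∀ {δ ε : Formula m} → Relativises δ → Relativises ε → Relativises (δ ∨ᶠ ε)
  relativises-∨ r r′ e = ∨E h₀ (relativise r h₀ (cut e (∨I₁ h₀))) (relativise r′ h₀ (cut e (∨I₂ h₀)))

  relativises-∃ : ∀ {δ : Formula (suc m)} → Relativises δ → Relativises (∃ᶠ δ)
  relativises-∃ r {χ} {χ′} e = ∃E h₀ (cast (sym (cong₂ _⇔_ (wk-□ χ) (wk-□ χ′)))
    (relativise r h₀ (cut (sub-⊢ (var ∘ suc) (∷-∈ (var ∘ suc) λ ()) e)
      (∃I-x₀ h₀))))

  relativises-∃^ : ∀ k {δ : Formula (k + m)} → Relativises δ → Relativises (∃^ k δ)
  relativises-∃^ zero    r = r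
  relativises-∃^ (suc k) r = relativises-∃^ k (relativises-∃ r)

  -- `Relativises` speaks of derivations and cannot be the formula of an induction in `S`; this
  -- formula can. Its instances for all ψ suffice: if χ ↔ χ′ follows from δ, then δ ∧ χ ↔ δ ∧ χ′ is
  -- provable outright.
  Harmless : Formula m → Formula m → Formula m
  Harmless δ ψ = δ ⇒ (□ (δ ∧ᶠ ψ) ⇔ □ ψ)

  sub-harmless : ∀ {m n} {σ : Fin m → Term n} → Simple σ → ∀ δ ψ →
                 sub σ (Harmless δ ψ) ≡ Harmless (sub σ δ) (sub σ ψ)
  sub-harmless {σ = σ} s δ ψ = cong₂ (λ φ φ′ → sub σ δ ⇒ (φ ⇔ φ′)) (sub-□ s (δ ∧ᶠ ψ)) (sub-□ s ψ)

  harmless⇒relativises : ∀ {δ : Formula m} → (∀ ψ → S ⊢ Harmless δ ψ) → Relativises δ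
  harmless⇒relativises h {χ} {χ′} e =
    ⇔-trans (⇔-sym (⇒E (weaken₀ (h χ)) h₀)) (⇔-trans (□-⇔ (∧-⇔ e)) (⇒E (weaken₀ (h χ′)) h₀))

  -- Under x = t, Leibniz replaces x by `t` in the goal, and a simple `t` may be moved inside □.
  -- What remains is `□-⇔` for χ(t) ↔ χ′(t), whose hypothesis has become t = t.
  relativises-point : ∀ {t : Term m} → Simpleᵗ t → Relativises (x₀ ≐ wkᵗ t)
  relativises-point {t = t} s {χ} {χ′} e =
    ⇔E₂ (Leibniz-x₀ (□ χ ⇔ □ χ′) t h₀)
      (cast (cong₂ (λ φ φ′ → wk (φ ⇔ φ′)) (sym (sub-□ (simple-inst s) χ)) (sym (sub-□ (simple-inst s) χ′)))
        (sub-⊢ {Γ = []} (var ∘ suc) (λ ()) (□-⇔ (⇒E (sub-⊢ (inst t) (λ ()) (⇒I e))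
          (cast (cong (t ≐_) (sym (subᵗ-inst-wkᵗ t t))) (=I t))))))

  -- The argument of `relativises-∧` for x = t and θ(x), with x a fresh name for `t`: θ(x) moves
  -- inside □, where together with x = t it yields θ(t).
  relativises-let : ∀ {t : Term m} → Relativises (x₀ ≐ wkᵗ t) →
                    ∀ {θ : Formula (suc m)} → Relativises θ → Relativises (θ [ t ])
  relativises-let {t = t} rₜ {θ} r {χ} {χ′} e = let-∃ t (cast (sym (cong₂ _⇔_ (wk-□ χ) (wk-□ χ′)))
    (⇔-trans (⇔-sym (relativise r hθ ∧-absorb))
      (⇔-trans (relativise rₜ h₀ (∧-⇔ (cut (sub-⊢ (var ∘ suc) (∷-∈ (var ∘ suc) λ ()) e)
                 (⇔E₁ (Leibniz-x₀ θ t h₁) h₀))))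
        (relativise r hθ ∧-absorb))))
    where
    hθ : S ∣ (x₀ ≐ wkᵗ t) ∷ wk (θ [ t ]) ∷ [] ⊢ θ
    hθ = ⇔E₂ (Leibniz-x₀ θ t h₀) h₁

  -- θ is read as a relation between y (index 0) and b (index 1); κ has a further
  -- variable w (index 0).

  at-0 : Formula (suc (suc m)) → Formula (suc m)
  at-0 = sub (lift (inst 0ᵗ))

  at-s : Formula (suc (suc m)) → Formula (suc (suc m))
  at-s = sub (lift s-at₀)

  -- The result is θ(w, b): y is now index 1 and does not occur, as w has taken its place.
  at-w : Formula (suc (suc m)) → Formula (suc (suc (suc m)))
  at-w = sub (lift (var ∘ suc))

  -- An abstract recursion on b: under κ, θ(y, b + 1) reduces to θ(w, b), and `pred` supplies such a
  -- w. For + the formula κ is y = w + 1, and for × it is y = w + a; for bounded ∀ it is the matrix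
  -- at b + 1, with y and w idle.
  module _ (θ : Formula (suc (suc m))) (κ : Formula (suc (suc (suc m))))
    (r₀ : Relativises (at-0 θ)) (rκ : Relativises κ)
    (step : T ∣ κ ∷ [] ⊢ wk (at-s θ) ⇔ at-w θ) (pred : S ∣ at-s θ ∷ [] ⊢ ∃ᶠ (κ ∧ᶠ at-w θ))
    where

    -- Induction in `S` on b. The induction formula quantifies over y because the step passes from y
    -- to w, and ψ mentions neither y nor b, so it stays fixed throughout.
    harmless-rec : ∀ ψ → S ⊢ Harmless θ (wk (wk ψ))
    harmless-rec ψ = ∀E₀ (induct PA≼S (∀ᶠ Harmless θ (wk (wk ψ)))
      (cast (sym K₀) (∀I (⇒I (relativise r₀ h₀ ∧-absorb))))
      (cast (sym Kₛ) (∀I (⇒I (∃E (cut pred h₀) (cast (sym K″)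
        -- As `κ` relativises, □(θ(y, b + 1) ∧ ψ) is equivalent to □(θ(w, b) ∧ ψ), and the induction
        -- hypothesis at w makes this equivalent to □ψ.
        (⇔-trans (relativise rκ (∧E₁ h₀) (∧-⇔ˡ step))
          (⇒E (cast Kʷ (∀E h₂ x₀)) (∧E₂ h₀)))))))))
      where
      K₀ : (∀ᶠ Harmless θ (wk (wk ψ))) [ 0ᵗ ] ≡ (∀ᶠ Harmless (at-0 θ) (wk ψ))
      K₀ = cong ∀ᶠ_ (trans (sub-harmless simple-lift-inst-0 θ (wk (wk ψ)))
        (cong (Harmless (at-0 θ)) (trans (sub-lift-wk (inst 0ᵗ) (wk ψ)) (cong wk (wk-[] ψ 0ᵗ)))))
      Kₛ : sub s-at₀ (∀ᶠ Harmless θ (wk (wk ψ))) ≡ (∀ᶠ Harmless (at-s θ) (wk (wk ψ)))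
      Kₛ = cong ∀ᶠ_ (trans (sub-harmless simple-lift-s-at₀ θ (wk (wk ψ)))
        (cong (Harmless (at-s θ)) (trans (sub-lift-wk s-at₀ (wk ψ)) (cong wk (sub-fuse (λ _ → refl) ψ)))))
      K″ : wk (□ (at-s θ ∧ᶠ wk (wk ψ)) ⇔ □ (wk (wk ψ))) ≡ (□ (wk (at-s θ) ∧ᶠ wk (wk (wk ψ))) ⇔ □ (wk (wk (wk ψ))))
      K″ = cong₂ _⇔_ (wk-□ (at-s θ ∧ᶠ wk (wk ψ))) (wk-□ (wk (wk ψ)))
      Kʷ : sub (inst x₀) (sub (lift (var ∘ suc)) (sub (lift (var ∘ suc)) (Harmless θ (wk (wk ψ))))) ≡
           Harmless (at-w θ) (wk (wk (wk ψ)))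
      Kʷ = trans (cong (sub (inst x₀)) (sub-sub (lift (var ∘ suc)) (lift (var ∘ suc)) (Harmless θ (wk (wk ψ)))))
        (trans (sub-fuse {ρ = lift (var ∘ suc)} (λ { zero → refl ; (suc i) → refl }) (Harmless θ (wk (wk ψ))))
          (trans (sub-harmless simple-lift-suc θ (wk (wk ψ)))
            (cong (Harmless (at-w θ)) (sub-lift-wk (var ∘ suc) (wk ψ)))))

    -- Only after the induction are y and b identified with variables that may occur in ψ.
    relativises-rec : ∀ i j → Relativises (sub (inst₂ (var i) (var j)) θ)
    relativises-rec i j = harmless⇒relativises λ ψ → cast
      (trans (sub-harmless s θ (wk (wk ψ)))
        (cong (Harmless (sub (inst₂ (var i) (var j)) θ)) (trans (sub-fuse {ρ = inst (var j)} (λ { zero → refl ; (suc _) → refl }) (wk ψ)) (wk-[] ψ (var j)))))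
      (sub-⊢ (inst₂ (var i) (var j)) (λ ()) (harmless-rec ψ))
      where
      s : Simple (inst₂ (var i) (var j))
      s zero          = refl , refl
      s (suc zero)    = refl , refl
      s (suc (suc k)) = refl , refl

  -- Graphs of successor, addition and multiplication; equations between terms

  relativises-s : ∀ (i j : Fin m) → Relativises (var i ≐ sᵗ (var j))
  relativises-s i j = relativises-let {t = var i} (relativises-point (refl , refl))
    (relativises-point {t = sᵗ (var j)} (refl , refl))

  relativises-+ : ∀ (i j k : Fin m) → Relativises (var i ≐ var j +ᵗ var k)
  relativises-+ i j k = relativises-rec (x₀ ≐ var (suc (suc j)) +ᵗ x₁) (x₁ ≐ sᵗ x₀)
    (relativises-⇔ (⇔I (≐-trans h₀ (+ᵗ-0 _)) (≐-trans h₀ (≐-sym (+ᵗ-0 _))))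
      (relativises-point {t = var j} (refl , refl)))
    (relativises-s _ _)
    (extend PA≼T (⇔I (sᵗ-injective (≐-trans (≐-sym h₁) (≐-trans h₀ (+ᵗ-s _ _))))
                     (≐-trans h₁ (≐-trans (s-cong h₀) (≐-sym (+ᵗ-s _ _))))))
    (extend PA≼S (∃I (var (suc (suc j)) +ᵗ x₁) (∧I (≐-trans h₀ (+ᵗ-s _ _)) (=I _))))
    i k

  relativises-× : ∀ (i j k : Fin m) → Relativises (var i ≐ var j ×ᵗ var k)
  relativises-× i j k = relativises-rec (x₀ ≐ a ×ᵗ x₁) (x₁ ≐ x₀ +ᵗ var (suc (suc (suc j))))
    (relativises-⇔ (⇔I (≐-trans h₀ (×ᵗ-0 _)) (≐-trans h₀ (≐-sym (×ᵗ-0 _))))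
      (relativises-point {t = 0ᵗ} (refl , refl)))
    (relativises-+ _ _ _)
    (extend PA≼T (⇔I (+ᵗ-cancelʳ _ (≐-trans (≐-sym h₁) (≐-trans h₀ (×ᵗ-s _ _))))
                     (≐-trans h₁ (≐-trans (+-cong h₀ (=I _)) (≐-sym (×ᵗ-s _ _))))))
    (extend PA≼S (∃I (a ×ᵗ x₁) (∧I (≐-trans h₀ (×ᵗ-s _ _)) (=I _))))
    i k
    where
    a = var (suc (suc j))

  -- The renaming keeps the recursion structural: arguments are needed in weakened contexts, and
  -- `wkᵗ t` is not a subterm. For + and ×, both arguments get fresh names, which leaves the graph
  -- of the operation on variables.
  relativises-value : ∀ {m n} (t : Term m) (ρ : Fin m → Fin n) → Relativises (x₀ ≐ wkᵗ (renᵗ ρ t))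
  relativises-value′ : ∀ {m n} (t : Term m) {u : Term n} (ρ : Fin m → Fin n) → renᵗ ρ t ≡ u →
                       Relativises (x₀ ≐ wkᵗ u)
  relativises-value′ t ρ refl = relativises-value t ρ

  relativises-value (var i)  ρ = relativises-point {t = var (ρ i)} (refl , refl)
  relativises-value 0ᵗ       ρ = relativises-point {t = 0ᵗ} (refl , refl)
  relativises-value (sᵗ t)   ρ =
    relativises-let (relativises-value′ t (suc ∘ ρ) (sym (renᵗ-renᵗ suc ρ t)))
      (relativises-s (suc zero) zero)
  relativises-value (t +ᵗ u) ρ = subst (λ v → Relativises (x₀ ≐ wkᵗ (renᵗ ρ t) +ᵗ v)) (subᵗ-inst-wkᵗ _ _)
    (relativises-let (relativises-value′ t (suc ∘ ρ) (sym (renᵗ-renᵗ suc ρ t)))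
      (relativises-let (relativises-value′ u (λ i → suc (suc (ρ i)))
          (trans (sym (renᵗ-renᵗ suc (suc ∘ ρ) u)) (cong wkᵗ (sym (renᵗ-renᵗ suc ρ u)))))
        (relativises-+ (suc (suc zero)) (suc zero) zero)))
  relativises-value (t ×ᵗ u) ρ = subst (λ v → Relativises (x₀ ≐ wkᵗ (renᵗ ρ t) ×ᵗ v)) (subᵗ-inst-wkᵗ _ _)
    (relativises-let (relativises-value′ t (suc ∘ ρ) (sym (renᵗ-renᵗ suc ρ t)))
      (relativises-let (relativises-value′ u (λ i → suc (suc (ρ i)))
          (trans (sym (renᵗ-renᵗ suc (suc ∘ ρ) u)) (cong wkᵗ (sym (renᵗ-renᵗ suc ρ u)))))
        (relativises-× (suc (suc zero)) (suc zero) zero)))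

  relativises-x₀≐ : ∀ (t : Term m) → Relativises (x₀ ≐ wkᵗ t)
  relativises-x₀≐ t = relativises-value′ t (λ i → i) (trans (renᵗ≡subᵗ _ t) (subᵗ-id t))

  relativises-≐ : ∀ (t u : Term m) → Relativises (t ≐ u)
  relativises-≐ t u = subst (λ v → Relativises (t ≐ v)) (subᵗ-inst-wkᵗ t u)
    (relativises-let (relativises-x₀≐ t) (relativises-x₀≐ u))

  relativises-≢ : ∀ (t u : Term m) → Relativises (¬ᶠ (t ≐ u))
  relativises-≢ t u = relativises-⇔ (≢⇔∃ t u)
    (relativises-∨ (relativises-∃ (relativises-≐ _ _)) (relativises-∃ (relativises-≐ _ _)))

  module _ (B : Formula (suc m)) (rB : ∀ {n} (τ : Fin (suc m) → Term n) → Relativises (sub τ B)) where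

    -- `B` may itself mention `var j`. So `τ` keeps the variables of `B` as parameters apart from
    -- the bound b, and `var j` is put for b only at the end.
    relativises-∀≤var : ∀ j → Relativises (∀ᶠ (x₀ ≤ᶠ var (suc j) ⇒ B))
    relativises-∀≤var j = subst (λ φ → Relativises (∀ᶠ (x₀ ≤ᶠ var (suc j) ⇒ φ)))
      (trans (sub-sub _ τ B) (sub-id (λ { zero → refl ; (suc i) → refl }) B))
      (relativises-rec (∀ᶠ (x₀ ≤ᶠ x₂ ⇒ sub τ B)) κ
        (relativises-⇔ (∀≤0⇔ _) (subst Relativises (sym (trans (cong (sub _) (sub-sub _ τ B)) (sub-sub _ _ B))) (rB _)))
        rκ
        (extend PA≼T (⇔I (∧E₁ (⇔E₁ (weaken₀ unfold) h₀)) (⇔E₂ (weaken₀ unfold) (∧I h₀ h₁))))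
        -- Neither `κ` nor the instance of θ contains w, so any witness serves.
        (∃I 0ᵗ (sub-instance (extend PA≼S (∧I (∧E₂ (⇔E₁ (weaken₀ unfold) h₀)) (∧E₁ (⇔E₁ (weaken₀ unfold) h₀))))))
        j j)
      where
      τ : Fin (suc m) → Term (suc (suc (suc m)))
      τ zero    = x₀
      τ (suc i) = var (suc (suc (suc i)))
      B′ : Formula (suc (suc (suc (suc m))))
      B′ = sub (lift (lift (var ∘ suc))) (sub τ B)
      κ = B′ [ sᵗ x₂ ]
      rκ : Relativises κ
      rκ = subst Relativises (sym (trans (cong (sub _) (sub-sub _ τ B)) (sub-sub _ _ B))) (rB _)
      unfold : PA ⊢ wk (sub (lift s-at₀) (∀ᶠ (x₀ ≤ᶠ x₂ ⇒ sub τ B))) ⇔ (∀ᶠ (x₀ ≤ᶠ x₃ ⇒ B′)) ∧ᶠ κ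
      unfold = cast (cong (λ φ → (∀ᶠ (x₀ ≤ᶠ sᵗ x₃ ⇒ φ)) ⇔ (∀ᶠ (x₀ ≤ᶠ x₃ ⇒ B′)) ∧ᶠ κ)
        (trans (sub-sub _ τ B) (sym (trans (cong (sub _) (sub-sub _ τ B))
          (sub-fuse (λ { zero → refl ; (suc i) → refl }) B)))))
        (∀≤s⇔ (suc (suc zero)) B′)
      sub-instance : ∀ {n} {φ : Formula n} {ψ : Formula (suc n)} → S ∣ wk φ ∷ [] ⊢ ψ → S ∣ φ ∷ [] ⊢ ψ [ 0ᵗ ]
      sub-instance {φ = φ} d = sub-⊢ (inst 0ᵗ) (λ { (here refl) → here (wk-[] φ 0ᵗ) }) d

  relativises-∀≤ : ∀ (t : Term m) (B : Formula (suc m)) →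
    (∀ {n} (τ : Fin (suc m) → Term n) → Relativises (sub τ B)) → Relativises (∀ᶠ (x₀ ≤ᶠ wkᵗ t ⇒ B))
  relativises-∀≤ t B rB = subst (λ φ → Relativises (∀ᶠ (x₀ ≤ᶠ wkᵗ t ⇒ φ)))
    (trans (sub-sub _ τ B) (sub-id (λ { zero → refl ; (suc i) → refl }) B))
    (relativises-let (relativises-x₀≐ t) (relativises-∀≤var (sub τ B)
      (λ τ′ → subst Relativises (sym (sub-sub τ′ τ B)) (rB _)) zero))
    where
    τ : Fin (suc _) → Term (suc (suc _))
    τ zero    = x₀
    τ (suc i) = var (suc (suc i))

  -- Δ₀ formulas, their negations, and Σ₁ formulas

  relativises-≤ : ∀ (t u : Term m) → Relativises (t ≤ᶠ u)
  relativises-≤ t u = relativises-⇔ (≤⇔∃ t u) (relativises-∃ (relativises-≐ _ _))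

  relativises-≰ : ∀ (t u : Term m) → Relativises (¬ᶠ (t ≤ᶠ u))
  relativises-≰ t u = relativises-⇔ (≰⇔∃ t u) (relativises-∃ (relativises-≐ _ _))

  -- All substitution instances are treated at once because `relativises-∀≤` asks this of its
  -- matrix. Negations are carried along since an implication needs that of its antecedent.
  relativises-Δ₀ : ∀ {m n} {δ : Formula m} → Δ₀ δ → (σ : Fin m → Term n) → Relativises (sub σ δ)
  relativises-¬Δ₀ : ∀ {m n} {δ : Formula m} → Δ₀ δ → (σ : Fin m → Term n) → Relativises (¬ᶠ sub σ δ)

  relativises-Δ₀ eq         σ = relativises-≐ _ _
  relativises-Δ₀ le         σ = relativises-≤ _ _
  relativises-Δ₀ bot        σ = λ _ → ex-falso h₀
  relativises-Δ₀ (imp d e)  σ = relativises-⇔ ⇒⇔¬∨ (relativises-∨ (relativises-¬Δ₀ d σ) (relativises-Δ₀ e σ))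
  relativises-Δ₀ (conj d e) σ = relativises-∧ (relativises-Δ₀ d σ) (relativises-Δ₀ e σ)
  relativises-Δ₀ (disj d e) σ = relativises-∨ (relativises-Δ₀ d σ) (relativises-Δ₀ e σ)
  relativises-Δ₀ (ball t {φ} d) σ =
    subst (λ u → Relativises (∀ᶠ (x₀ ≤ᶠ u ⇒ sub (lift σ) φ))) (sym (subᵗ-lift-wkᵗ σ t))
      (relativises-∀≤ (subᵗ σ t) (sub (lift σ) φ)
        λ τ → subst Relativises (sym (sub-sub τ (lift σ) φ)) (relativises-Δ₀ d _))
  relativises-Δ₀ (bex t d)  σ = relativises-∃ (relativises-∧ (relativises-≤ _ _) (relativises-Δ₀ d (lift σ)))

  relativises-¬Δ₀ eq         σ = relativises-≢ _ _
  relativises-¬Δ₀ le         σ = relativises-≰ _ _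
  relativises-¬Δ₀ bot        σ = relativises-⇔ (⇔I (=I 0ᵗ) (⇒I h₀)) (relativises-≐ _ _)
  relativises-¬Δ₀ (imp d e)  σ = relativises-⇔ ¬⇒⇔∧¬ (relativises-∧ (relativises-Δ₀ d σ) (relativises-¬Δ₀ e σ))
  relativises-¬Δ₀ (conj d e) σ = relativises-⇔ ¬∧⇔¬∨¬ (relativises-∨ (relativises-¬Δ₀ d σ) (relativises-¬Δ₀ e σ))
  relativises-¬Δ₀ (disj d e) σ = relativises-⇔ ¬∨⇔¬∧¬ (relativises-∧ (relativises-¬Δ₀ d σ) (relativises-¬Δ₀ e σ))
  relativises-¬Δ₀ (ball t d) σ = relativises-⇔ ¬∀⇔∃¬
    (relativises-∃ (relativises-∧ (relativises-≤ _ _) (relativises-¬Δ₀ d (lift σ))))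
  relativises-¬Δ₀ (bex t {φ} d) σ = relativises-⇔ ¬∃⇔∀¬
    (subst (λ u → Relativises (∀ᶠ (x₀ ≤ᶠ u ⇒ ¬ᶠ sub (lift σ) φ))) (sym (subᵗ-lift-wkᵗ σ t))
      (relativises-∀≤ (subᵗ σ t) (¬ᶠ sub (lift σ) φ)
        λ τ → subst (λ ψ → Relativises (¬ᶠ ψ)) (sym (sub-sub τ (lift σ) φ)) (relativises-¬Δ₀ d _)))

  relativises-Σ₁ : ∀ {φ : Formula m} → Σ₁ φ → Relativises φ
  relativises-Σ₁ (k , δ , d , refl) = relativises-∃^ k
    (subst Relativises (sub-id (λ _ → refl) δ) (relativises-Δ₀ d var))

-- Undotted codes

module _ {S : Theory} {Pr : Formula 1} (PA≼S : PA ≼ S) where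

  -- `⌜ 0 ∙ φ ⌝` is a closed compound term with value `gn φ`, not the numeral itself; evaluating it
  -- in PA identifies the two.
  Pr-0∙ : ∀ (φ : Formula n) → S ∣ Γ ⊢ Pr ⟨ ⌜ 0 ∙ φ ⌝ ⟩ ⇔ Pr ⟨ ⌜ φ ⌝ ⟩
  Pr-0∙ φ = weaken₀ (Leibniz-⟨⟩ Pr (PA≼S _ (cast
    (cong (λ c → ⌜ 0 ∙ φ ⌝ ≐ numeral c) (trans (dotted-correct 0 (λ ()) φ) (cong gn (sub-id (λ _ → refl) φ))))
    (evaluate (λ ()) ⌜ 0 ∙ φ ⌝))))

  module _ {T : Theory} (PA≼T : PA ≼ T) (eᵁ : Eᵁ S T Pr) where

    Pr-⇔ : ∀ {φ ψ : Formula n} → T ⊢ φ ⇔ ψ → S ∣ Γ ⊢ Pr ⟨ ⌜ φ ⌝ ⟩ ⇔ Pr ⟨ ⌜ ψ ⌝ ⟩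
    Pr-⇔ {φ = φ} {ψ} d = ⇔-trans (⇔-sym (Pr-0∙ φ)) (⇔-trans (weaken₀ (eᵁ 0 φ ψ d)) (Pr-0∙ ψ))

    -- ψ is equivalent to ∃x χ(x) and φ to χ(0), where χ(x) says φ if x = 0
    -- and ψ otherwise.
    Pr-mono : CB∃ S Pr → ∀ {φ ψ : Formula n} → T ∣ φ ∷ [] ⊢ ψ → S ∣ Γ ⊢ Pr ⟨ ⌜ φ ⌝ ⟩ → S ∣ Γ ⊢ Pr ⟨ ⌜ ψ ⌝ ⟩
    Pr-mono cb {φ} {ψ} d e = ⇔E₁ (Pr-⇔ ∃χ⇔ψ) (⇒E (weaken₀ (cb 1 χ)) (∃I 0ᵗ
      (cast (sym (trans (sub-⟨⟩ (inst 0ᵗ) Pr ⌜ 1 ∙ χ ⌝) (cong (Pr ⟨_⟩) dotted-χ0)))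
        (⇔E₂ (Pr-0∙ (χ [ 0ᵗ ])) (⇔E₂ (Pr-⇔ χ0⇔φ) e)))))
      where
      χ = ((x₀ ≐ 0ᵗ) ∧ᶠ wk φ) ∨ᶠ ((¬ᶠ (x₀ ≐ 0ᵗ)) ∧ᶠ wk ψ)
      dotted-χ0 : subᵗ (inst 0ᵗ) ⌜ 1 ∙ χ ⌝ ≡ ⌜ 0 ∙ χ [ 0ᵗ ] ⌝
      -- The dotted x is replaced by the simple term 0. The other variables keep their coded index,
      -- since `firstDotted 1` already counts them from after x.
      dotted-χ0 = sub-dot (inst 0ᵗ) (firstDotted 1) (firstDotted 0) (inst 0ᵗ)
        (λ { zero → refl , refl ; (suc i) → i , refl , refl }) χ
      χ0⇔φ : T ⊢ χ [ 0ᵗ ] ⇔ φ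
      χ0⇔φ = ⇔I (∨E h₀ (cast (wk-[] φ 0ᵗ) (∧E₂ h₀)) (ex-falso (⇒E (∧E₁ h₀) (=I 0ᵗ))))
                (∨I₁ (∧I (=I 0ᵗ) (cast (sym (wk-[] φ 0ᵗ)) h₀)))
      ∃χ⇔ψ : T ⊢ ∃ᶠ χ ⇔ ψ
      -- Either disjunct gives ψ, the first because ψ follows from φ. Conversely, a nonzero witness
      -- selects the second disjunct.
      ∃χ⇔ψ = ⇔I (∃E h₀ (∨E h₀ (cut (sub-⊢ (var ∘ suc) (∷-∈ (var ∘ suc) λ ()) d) (∧E₂ h₀)) (∧E₂ h₀)))
        (∃I (sᵗ 0ᵗ) (∨I₂ (∧I (⇒I (extend PA≼T (sᵗ≢0 0ᵗ h₀))) (cast (sym (wk-[] ψ (sᵗ 0ᵗ))) h₀))))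

-- Derivation of D2 and D3

corollary3p18 : (S T : Theory) →
    Consistent S → CE S → PA ≼ S →
    Consistent T → CE T → PA ≼ T →
    S ≼ T →
    (Pr : Formula 1) →
    Σ₁ Pr →
    ProvabilityPredicate S T Pr →
    Eᵁ S T Pr → CB∃ S Pr → C S Pr →
    D2 S Pr × D3 S Pr
corollary3p18 S T _ _ PA≼S _ _ PA≼T _ Pr Σ₁Pr pp eᵁ cb c = d2 , d3
  where
  open Relativisation PA≼S PA≼T eᵁ

  d2 : D2 S Pr
  d2 φ ψ = ⇒I (⇒I (Pr-mono PA≼S PA≼T eᵁ cb {φ = (φ ⇒ ψ) ∧ᶠ φ} {ψ}
    (⇒E (∧E₁ h₀) (∧E₂ h₀)) (⇒E (weaken₀ (c (φ ⇒ ψ) φ)) (∧I h₁ h₀))))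

  □⇔Pr : ∀ (φ : Sentence) → S ∣ Γ ⊢ □ φ ⇔ Pr ⟨ ⌜ φ ⌝ ⟩
  □⇔Pr φ = cast (cong (λ t → Pr ⟨ t ⟩ ⇔ Pr ⟨ ⌜ φ ⌝ ⟩) (⌜∙⌝≡⌜⌝˙ 0 φ)) (Pr-0∙ PA≼S φ)

  ⊤ᶠ : ∀ {n} → Formula n
  ⊤ᶠ = ¬ᶠ ⊥ᶠ

  d3 : D3 S Pr
  d3 φ = ⇒I (⇔E₁ (□⇔Pr (Pr ⟨ ⌜ φ ⌝ ⟩)) (⇔E₂ □Pr⇔□⊤ (⇔E₂ (□⇔Pr ⊤ᶠ) (weaken₀ (Equivalence.to (pp {0} ⊤ᶠ) (⇒I h₀))))))
    where
    s : Simple (const {B = Fin 1} ⌜ φ ⌝)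
    s _ = simple-numeral (gn φ)
    □Pr⇔□⊤ : S ∣ Pr ⟨ ⌜ φ ⌝ ⟩ ∷ [] ⊢ □ (Pr ⟨ ⌜ φ ⌝ ⟩) ⇔ □ ⊤ᶠ
    -- Under Pr(x), `relativises-Σ₁` gives □Pr(x) ↔ □⊤; then `⌜ φ ⌝` is put for x. A numeral is
    -- simple, so the substitution passes into the dotted code.
    □Pr⇔□⊤ = cast (cong₂ _⇔_ (sub-□ s Pr) (sub-□ s ⊤ᶠ)) (sub-⊢ (const ⌜ φ ⌝) (∷-∈ _ λ ())
      (relativises-Σ₁ Σ₁Pr {Pr} {⊤ᶠ} (⇔I (⇒I h₀) h₁)))
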